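{- There is an absolute constant $c>0$ such that the following holds. Let $d,k\ge 1$ be integers, let $G$ be a graph without isolated vertices with $d\text{ - }pw(G)\ge k$, and let $Z$ be a $d$-SMNBP representing $\psi(G)$. Then $|Z| \geq c\,\beta^k$ where $\beta=(8/7)^{1/12}$.
   Context: For a graph $G$ without isolated vertices, $\psi(G)$ is the CNF with variable set $V(G)\cup E(G)$ and, for each edge $e=\{u,v\}$, the clause $(u\vee e\vee v)$. The $d$-pathwidth $d\text{ - }pw(G)$ is the smallest $k$ such that there are subgraphs $G_1,\dots,G_d$ of $G$, each of pathwidth at most $k$, with $G=G_1\cup\dots\cup G_d$. A nondeterministic branching program (NBP) $Z$ is a directed acyclic graph, multiple edges allowed, with one source and one sink, some of whose edges are labelled with literals; $Var(Z)$ is the set of variables labelling edges. A path is consistent if it does not contain both a variable and its negation among its labels; $A(P)$ is the set of labels of $P$. A satisfying assignment of $Z$ is an assignment $S$ to $Var(Z)$ (a set of literals containing exactly one literal of each variable of $Var(Z)$) such that some consistent source-sink path $P$ has $A(P)\subseteq S$. $Z$ represents a CNF if it has the same set of satisfying assignments. $|Z|$ is the number of edges. $Z$ is monotone if no edge is labelled with a negative literal. A path is read-once if no two of its edges are labelled with the same variable. A $d$-SMNBP is a monotone NBP in which along every path each variable labels at most $d$ edges, and every source-sink path can be partitioned into at most $d$ edge-disjoint consecutive read-once subpaths. -}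

module Defs where

open import Data.Nat using (ℕ; zero; suc; _+_; _*_; _^_; _≤_)
open import Data.Fin using (Fin) renaming (_≤_ to _≤ᶠ_; _≟_ to _≟ᶠ_)
open import Data.Fin.Subset using (Subset; ∣_∣) renaming (_∈_ to _∈ˢ_; _⊆_ to _⊆ˢ_)
open import Data.Bool using (Bool; true; false)
open import Data.Maybe using (Maybe; just; nothing)
open import Data.List using (List; []; _∷_; length; concat; map; mapMaybe)
open import Data.List.Relation.Unary.All using (All)
open import Data.List.Relation.Unary.Any using (Any)
open import Data.List.Membership.Propositional renaming (_∈_ to _∈ˡ_)
open import Data.Product using (Σ; ∃; _×_; _,_; proj₁; proj₂)
open import Data.Sum using (_⊎_; inj₁; inj₂)
open import Data.Sum.Properties using (≡-dec)
open import Relation.Binary.PropositionalEquality using (_≡_; _≢_)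
open import Relation.Binary.Definitions using (DecidableEquality)
open import Relation.Nullary using (¬_; yes; no)
open import Function.Bundles using (_⇔_)

record Graph : Set where
  field
    n m   : ℕ
    ends  : Fin m → Fin n × Fin n
    loopless : ∀ e → proj₁ (ends e) ≢ proj₂ (ends e)
    simple : ∀ e f →
      (proj₁ (ends e) ≡ proj₁ (ends f) × proj₂ (ends e) ≡ proj₂ (ends f))
      ⊎ (proj₁ (ends e) ≡ proj₂ (ends f) × proj₂ (ends e) ≡ proj₁ (ends f))
      → e ≡ f

open Graph public

Incident : (G : Graph) → Fin (n G) → Fin (m G) → Set
Incident G v e = v ≡ proj₁ (ends G e) ⊎ v ≡ proj₂ (ends G e)

NoIsolatedVertices : Graph → Set
NoIsolatedVertices G = ∀ v → ∃ λ e → Incident G v e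

record SubgraphOf (G : Graph) : Set where
  field
    VS : Subset (n G)
    ES : Subset (m G)
    closed : ∀ e → e ∈ˢ ES → proj₁ (ends G e) ∈ˢ VS × proj₂ (ends G e) ∈ˢ VS

open SubgraphOf public

record PathDecomposition (G : Graph) (H : SubgraphOf G) (w : ℕ) : Set where
  field
    r   : ℕ
    bag : Fin r → Subset (n G)
    bag⊆ : ∀ i → bag i ⊆ˢ VS H
    vertexCover : ∀ v → v ∈ˢ VS H → ∃ λ i → v ∈ˢ bag i
    edgeCover : ∀ e → e ∈ˢ ES H →
      ∃ λ i → proj₁ (ends G e) ∈ˢ bag i × proj₂ (ends G e) ∈ˢ bag i
    interpolation : ∀ i j l v → i ≤ᶠ j → j ≤ᶠ l →
      v ∈ˢ bag i → v ∈ˢ bag l → v ∈ˢ bag j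
    width≤ : ∀ i → ∣ bag i ∣ ≤ suc w

PathwidthAtMost : (G : Graph) → SubgraphOf G → ℕ → Set
PathwidthAtMost G H w = PathDecomposition G H w

DPathwidthAtMost : Graph → ℕ → ℕ → Set
DPathwidthAtMost G d w =
  Σ (Fin d → SubgraphOf G) λ H →
    (∀ v → ∃ λ i → v ∈ˢ VS (H i)) ×
    (∀ e → ∃ λ i → e ∈ˢ ES (H i)) ×
    (∀ i → PathwidthAtMost G (H i) w)

DPathwidthAtLeast : Graph → ℕ → ℕ → Set
DPathwidthAtLeast G d k = ∀ w → DPathwidthAtMost G d w → k ≤ w

data Lit (X : Set) : Set where
  pos : X → Lit X
  neg : X → Lit X

litVar : {X : Set} → Lit X → X
litVar (pos x) = x
litVar (neg x) = x

-- an assignment (one literal per variable) as a Boolean function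
Assignment : Set → Set
Assignment X = X → Bool

Holds : {X : Set} → Assignment X → Lit X → Set
Holds S (pos x) = S x ≡ true
Holds S (neg x) = S x ≡ false

Clause : Set → Set
Clause X = List (Lit X)

CNF : Set → Set
CNF X = List (Clause X)

SatCNF : {X : Set} → CNF X → Assignment X → Set
SatCNF φ S = All (λ C → Any (Holds S) C) φ

PsiVar : Graph → Set
PsiVar G = Fin (n G) ⊎ Fin (m G)

psiVar-dec : (G : Graph) → DecidableEquality (PsiVar G)
psiVar-dec G = ≡-dec _≟ᶠ_ _≟ᶠ_

psiClause : (G : Graph) → Fin (m G) → Clause (PsiVar G)
psiClause G e =
  pos (inj₁ (proj₁ (ends G e))) ∷ pos (inj₂ e) ∷ pos (inj₁ (proj₂ (ends G e))) ∷ []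

psi : (G : Graph) → CNF (PsiVar G)
psi G = map (psiClause G) (Data.List.allFin (m G))
  where import Data.List

data IsPath {N M : ℕ} (src tgt : Fin M → Fin N) : Fin N → Fin N → List (Fin M) → Set where
  []  : ∀ {u} → IsPath src tgt u u []
  _∷_ : ∀ {u v e es} → src e ≡ u → IsPath src tgt (tgt e) v es →
        IsPath src tgt u v (e ∷ es)

record NBP (X : Set) : Set where
  field
    N M    : ℕ
    src tgt : Fin M → Fin N
    label  : Fin M → Maybe (Lit X)
    source sink : Fin N
    acyclic : ∀ u es → IsPath src tgt u u es → es ≡ []
    source-in : ∀ e → tgt e ≢ source
    sink-out  : ∀ e → src e ≢ sink
    source-unique : ∀ v → (∀ e → tgt e ≢ v) → v ≡ source
    sink-unique   : ∀ v → (∀ e → src e ≢ v) → v ≡ sink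

open NBP public

module _ {X : Set} (Z : NBP X) where

  Path : Fin (N Z) → Fin (N Z) → List (Fin (M Z)) → Set
  Path = IsPath (src Z) (tgt Z)

  labels : List (Fin (M Z)) → List (Lit X)
  labels es = mapMaybe (label Z) es

  Consistent : List (Fin (M Z)) → Set
  Consistent es = ∀ x → ¬ (pos x ∈ˡ labels es × neg x ∈ˡ labels es)

  VarOf : X → Set
  VarOf x = ∃ λ e → ∃ λ l → label Z e ≡ just l × litVar l ≡ x

  -- S is a satisfying assignment of Z (S is an assignment to Var(Z) = X)
  SatNBP : Assignment X → Set
  SatNBP S = ∃ λ es → Path (source Z) (sink Z) es × Consistent es ×
                      All (Holds S) (labels es)

  Represents : CNF X → Set
  Represents φ = (∀ x → VarOf x) × (∀ S → SatNBP S ⇔ SatCNF φ S)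

  Monotone : Set
  Monotone = ∀ e x → label Z e ≢ just (neg x)

  module _ (_≟_ : DecidableEquality X) where

    occ : X → List (Fin (M Z)) → ℕ
    occ x [] = 0
    occ x (e ∷ es) with label Z e
    ... | nothing = occ x es
    ... | just l with litVar l ≟ x
    ...   | yes _ = suc (occ x es)
    ...   | no  _ = occ x es

    ReadOnce : List (Fin (M Z)) → Set
    ReadOnce es = ∀ x → occ x es ≤ 1

    IsSMNBP : ℕ → Set
    IsSMNBP d =
      Monotone ×
      (∀ u v es → Path u v es → ∀ x → occ x es ≤ d) ×
      (∀ es → Path (source Z) (sink Z) es →
         ∃ λ (Ps : List (List (Fin (M Z)))) →
           length Ps ≤ d × concat Ps ≡ es × All ReadOnce Ps)

size : {X : Set} → NBP X → ℕ
size Z = M Z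

module Submission where

-- Cut every source-sink path where the number of read-once pieces needed to reach the sink drops. This gives at
-- most d segments such that every walk between the end edges of a segment, not only the given one, is read-once.
-- Replacing segments independently shows that each clause of ψ(G) is hit by all walks of some segment, so the
-- edges of G are split into at most d classes. At an edge q of a segment, a vertex of G is read only before q
-- (inclusive), only after q, or not at all; an edge of G in the class whose ends are neither both before nor both
-- after forces a 2-clause (U a or not U b) on the set U of true vertices. A matching of t such edges holds for a
-- (3/4)^t fraction of the sets U only, and it depends just on the three edges (first, q, last). Hence, if
-- |Z|^3 (3/4)^t < 1, some U avoids all of them, and on its path all cuts have crossing matchings smaller than t.
-- A maximal matching maintained greedily along the segment then turns each class into a path decomposition of
-- width at most 4 (t - 1). The classical choices involve finite families only and are made under a double negation.

open import Defs
open import Data.Nat using (ℕ; zero; suc; pred; _+_; _*_; _^_; _∸_; _/_; _≤_; _<_; z≤n; s≤s; ≤′-refl; ≤′-step; _≤′_)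
import Data.Nat.Properties as ℕ
open import Data.Nat.DivMod using (m≡m%n+[m/n]*n; m%n<n; m/n*n≤m)
open import Data.Nat.Tactic.RingSolver using (solve-∀)
open import Algebra.Properties.CommutativeSemigroup ℕ.+-commutativeSemigroup using (interchange)
open import Data.Bool using (Bool; true; false; not; _∧_; _∨_)
open import Data.Bool.Properties using (∨-zeroʳ)
open import Data.Fin using (Fin; zero; suc; toℕ; fromℕ<; combine; remQuot; quotient)
  renaming (_≟_ to _≟ᶠ_; _≤_ to _≤ᶠ_)
import Data.Fin.Properties as Fin
open import Data.Fin.Subset using (Subset; ⁅_⁆; _∪_; ∣_∣; inside; outside)
  renaming (_∈_ to _∈ˢ_; ⊤ to ⊤ˢ; ⊥ to ⊥ˢ)
import Data.Fin.Subset.Properties as Subset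
open import Data.Maybe using (Maybe; just; nothing)
import Data.Maybe as Maybe
import Data.Maybe.Properties as Maybe
open import Data.Vec using (Vec; []; _∷_; lookup; tabulate; _[_]≔_)
open import Data.Vec.Properties using (lookup⇒[]=; []=⇒lookup; lookup∘tabulate; lookup∘update; lookup∘update′)
open import Data.List using (List; []; _∷_; _++_; length; concat; foldr; filter; take; allFin; concatMap)
import Data.List.Properties as List
open import Data.List.Relation.Unary.All using (All; []; _∷_)
import Data.List.Relation.Unary.All as All
import Data.List.Relation.Unary.All.Properties as All
open import Data.List.Relation.Unary.Any using (Any; here; there; any?)
import Data.List.Relation.Unary.Any as Any
import Data.List.Relation.Unary.Any.Properties as Any
open import Data.List.Relation.Unary.AllPairs using (AllPairs; []; _∷_)
import Data.List.Relation.Unary.AllPairs.Properties as AllPairs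
open import Data.List.Membership.Propositional using (find; lose) renaming (_∈_ to _∈ˡ_)
open import Data.List.Membership.Propositional.Properties
  using (∈-++⁺ˡ; ∈-++⁺ʳ; ∈-++⁻; ∈-filter⁺; ∈-allFin; ∈-map⁺)
open import Data.Product using (Σ; ∃; ∃₂; _×_; _,_; proj₁; proj₂)
open import Data.Sum using (_⊎_; inj₁; inj₂; [_,_]′)
open import Data.Empty using (⊥; ⊥-elim)
open import Data.Unit using (⊤; tt)
open import Function using (_∘_; id; case_of_)
open import Function.Bundles using (Equivalence)
open import Relation.Binary.PropositionalEquality
open import Relation.Binary.Definitions using (DecidableEquality; tri<; tri≈; tri>)
open import Relation.Nullary using (¬_; Dec; yes; no; does)
open import Relation.Nullary.Decidable
  using (_×-dec_; _⊎-dec_; ¬?; dec-true; decidable-stable; ¬¬-excluded-middle)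

-- Path decompositions from cuts with small crossing matchings

fromList : ∀ {n} → List (Fin n) → Subset n
fromList = foldr (λ x p → ⁅ x ⁆ ∪ p) ⊥ˢ

∈-fromList⁺ : ∀ {n} {x : Fin n} {xs} → x ∈ˡ xs → x ∈ˢ fromList xs
∈-fromList⁺ {xs = y ∷ xs} (here refl) = Subset.x∈p∪q⁺ (inj₁ (Subset.x∈⁅x⁆ y))
∈-fromList⁺ (there x∈) = Subset.x∈p∪q⁺ (inj₂ (∈-fromList⁺ x∈))

∈-fromList⁻ : ∀ {n} {x : Fin n} xs → x ∈ˢ fromList xs → x ∈ˡ xs
∈-fromList⁻ [] x∈ = ⊥-elim (Subset.∉⊥ x∈)
∈-fromList⁻ (y ∷ xs) x∈ with Subset.x∈p∪q⁻ ⁅ y ⁆ (fromList xs) x∈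
... | inj₁ x∈y = here (Subset.x∈⁅y⁆⇒x≡y y x∈y)
... | inj₂ x∈xs = there (∈-fromList⁻ xs x∈xs)

∣p∪q∣≤∣p∣+∣q∣ : ∀ {n} (p q : Subset n) → ∣ p ∪ q ∣ ≤ ∣ p ∣ + ∣ q ∣
∣p∪q∣≤∣p∣+∣q∣ [] [] = z≤n
∣p∪q∣≤∣p∣+∣q∣ (outside ∷ p) (outside ∷ q) = ∣p∪q∣≤∣p∣+∣q∣ p q
∣p∪q∣≤∣p∣+∣q∣ (outside ∷ p) (inside ∷ q) rewrite ℕ.+-suc ∣ p ∣ ∣ q ∣ = s≤s (∣p∪q∣≤∣p∣+∣q∣ p q)
∣p∪q∣≤∣p∣+∣q∣ (inside ∷ p) (outside ∷ q) = s≤s (∣p∪q∣≤∣p∣+∣q∣ p q)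
∣p∪q∣≤∣p∣+∣q∣ (inside ∷ p) (inside ∷ q) =
  s≤s (ℕ.≤-trans (∣p∪q∣≤∣p∣+∣q∣ p q) (ℕ.+-monoʳ-≤ ∣ p ∣ (ℕ.n≤1+n ∣ q ∣)))

∣fromList∣≤length : ∀ {n} (xs : List (Fin n)) → ∣ fromList xs ∣ ≤ length xs
∣fromList∣≤length {n} [] = ℕ.≤-reflexive (Subset.∣⊥∣≡0 n)
∣fromList∣≤length (x ∷ xs) = ℕ.≤-trans (∣p∪q∣≤∣p∣+∣q∣ ⁅ x ⁆ (fromList xs))
  (ℕ.+-mono-≤ (ℕ.≤-reflexive (Subset.∣⁅x⁆∣≡1 x)) (∣fromList∣≤length xs))

module _ {n} {P : Fin n → Set} (P? : ∀ i → Dec (P i)) where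

  comprehension : Subset n
  comprehension = tabulate (does ∘ P?)

  ∈-comprehension⁺ : ∀ {i} → P i → i ∈ˢ comprehension
  ∈-comprehension⁺ {i} p =
    lookup⇒[]= i comprehension (trans (lookup∘tabulate (does ∘ P?) i) (dec-true (P? i) p))

  ∈-comprehension⁻ : ∀ {i} → i ∈ˢ comprehension → P i
  ∈-comprehension⁻ {i} i∈ with P? i | trans (sym (lookup∘tabulate (does ∘ P?) i)) ([]=⇒lookup i∈)
  ... | yes p | _ = p

onlyIf : ∀ {A P : Set} → Dec P → A → List A
onlyIf (yes _) x = x ∷ []
onlyIf (no _) x = []

∈-onlyIf⁺ : ∀ {A P : Set} {x : A} (P? : Dec P) → P → x ∈ˡ onlyIf P? x
∈-onlyIf⁺ (yes _) p = here refl
∈-onlyIf⁺ (no ¬p) p = ⊥-elim (¬p p)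

∈-onlyIf⁻ : ∀ {A P : Set} {x y : A} (P? : Dec P) → y ∈ˡ onlyIf P? x → y ≡ x × P
∈-onlyIf⁻ (yes p) (here refl) = refl , p

length-onlyIf : ∀ {A P : Set} {x : A} (P? : Dec P) → length (onlyIf P? x) ≤ 1
length-onlyIf (yes _) = ℕ.≤-refl
length-onlyIf (no _) = z≤n

-- Discrete intermediate value principle: descending from `l`, the first index where `P` holds is
-- the switch.
lastTrue : ∀ {P : ℕ → Set} → (∀ j → Dec (P j)) → ∀ {i l} → i ≤ l → P i → ¬ P l →
  ∃ λ j → i ≤ j × j < l × P j × ¬ P (suc j)
lastTrue {P} P? {i} = go ∘ ℕ.≤⇒≤′
  where
  go : ∀ {l} → i ≤′ l → P i → ¬ P l → ∃ λ j → i ≤ j × j < l × P j × ¬ P (suc j)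
  go ≤′-refl Pi ¬Pl = ⊥-elim (¬Pl Pi)
  go (≤′-step {l} i≤l) Pi ¬Pl with P? l
  ... | yes p = l , ℕ.≤′⇒≤ i≤l , ℕ.≤-refl , p , ¬Pl
  ... | no ¬p with go i≤l Pi ¬p
  ... | j , i≤j , j<l , r = j , i≤j , ℕ.m<n⇒m<1+n j<l , r

iterate : ∀ {P : ℕ → Set} → (∀ j → P j → P (suc j)) → ∀ {i l} → i ≤ l → P i → P l
iterate {P} step {i} = go ∘ ℕ.≤⇒≤′
  where
  go : ∀ {l} → i ≤′ l → P i → P l
  go ≤′-refl p = p
  go (≤′-step {l} i≤l) p = step l (go i≤l p)

-- Matchings and their maximal extensions

module _ (G : Graph) where

  Disjoint : Fin (m G) → Fin (m G) → Set
  Disjoint f g = ∀ v → Incident G v f → ¬ Incident G v g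

  Matching : List (Fin (m G)) → Set
  Matching = AllPairs Disjoint

  Incident? : ∀ v f → Dec (Incident G v f)
  Incident? v f = (v ≟ᶠ proj₁ (ends G f)) ⊎-dec (v ≟ᶠ proj₂ (ends G f))

  third-incident : ∀ {f u v w} → Incident G u f → Incident G v f → Incident G w f → v ≢ w →
    u ≡ v ⊎ u ≡ w
  third-incident (inj₁ refl) (inj₁ refl) w v≢w = inj₁ refl
  third-incident (inj₁ refl) (inj₂ refl) (inj₁ refl) v≢w = inj₂ refl
  third-incident (inj₁ refl) (inj₂ refl) (inj₂ refl) v≢w = ⊥-elim (v≢w refl)
  third-incident (inj₂ refl) (inj₂ refl) w v≢w = inj₁ refl
  third-incident (inj₂ refl) (inj₁ refl) (inj₂ refl) v≢w = inj₂ refl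
  third-incident (inj₂ refl) (inj₁ refl) (inj₁ refl) v≢w = ⊥-elim (v≢w refl)

  matching-unique : ∀ {fs f g v} → Matching fs → f ∈ˡ fs → g ∈ˡ fs →
    Incident G v f → Incident G v g → f ≡ g
  matching-unique _ (here refl) (here refl) _ _ = refl
  matching-unique (d ∷ _) (here refl) (there g∈) vf vg = ⊥-elim (All.lookup d g∈ _ vf vg)
  matching-unique (d ∷ _) (there f∈) (here refl) vf vg = ⊥-elim (All.lookup d f∈ _ vg vf)
  matching-unique (_ ∷ ds) (there f∈) (there g∈) vf vg = matching-unique ds f∈ g∈ vf vg

  Covered : List (Fin (m G)) → Fin (n G) → Set
  Covered fs v = ∃ λ f → f ∈ˡ fs × Incident G v f

  Covered? : ∀ fs v → Dec (Covered fs v)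
  Covered? fs v with any? (Incident? v) fs
  ... | yes a = yes (find a)
  ... | no ¬a = no λ (f , f∈ , vf) → ¬a (lose f∈ vf)

  vertices : List (Fin (m G)) → List (Fin (n G))
  vertices = concatMap λ f → proj₁ (ends G f) ∷ proj₂ (ends G f) ∷ []

  length-vertices : ∀ fs → length (vertices fs) ≡ 2 * length fs
  length-vertices [] = refl
  length-vertices (f ∷ fs) rewrite length-vertices fs = sym (ℕ.*-suc 2 (length fs))

  ∈-vertices⁺ : ∀ {fs v} → Covered fs v → v ∈ˡ vertices fs
  ∈-vertices⁺ (f , here refl , inj₁ refl) = here refl
  ∈-vertices⁺ (f , here refl , inj₂ refl) = there (here refl)
  ∈-vertices⁺ (f , there f∈ , vf) = there (there (∈-vertices⁺ (f , f∈ , vf)))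

  ∈-vertices⁻ : ∀ fs {v} → v ∈ˡ vertices fs → Covered fs v
  ∈-vertices⁻ (f ∷ fs) (here refl) = f , here refl , inj₁ refl
  ∈-vertices⁻ (f ∷ fs) (there (here refl)) = f , here refl , inj₂ refl
  ∈-vertices⁻ (f ∷ fs) (there (there v∈)) with ∈-vertices⁻ fs v∈
  ... | g , g∈ , vg = g , there g∈ , vg

  record MaximalExtension (E : Fin (m G) → Set) (fs : List (Fin (m G))) : Set where
    field
      edges    : List (Fin (m G))
      matching : Matching edges
      within   : All E edges
      extends  : ∀ {f} → f ∈ˡ fs → f ∈ˡ edges
      maximal  : ∀ f → E f → ∃ λ v → Incident G v f × Covered edges v

  abstract
    -- Greedy choice starting from `fs`: a candidate is added when both its ends are still
    -- uncovered, so each rejected edge of `E` already has a covered end.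
    extend : ∀ {E} → (∀ f → Dec (E f)) → ∀ fs → Matching fs → All E fs → MaximalExtension E fs
    extend {E} E? fs M W with go (allFin (m G))
      where
      go : ∀ cs → ∃ λ es → Matching es × All E es × (∀ {f} → f ∈ˡ fs → f ∈ˡ es) ×
        (∀ f → f ∈ˡ cs → E f → ∃ λ v → Incident G v f × Covered es v)
      go [] = fs , M , W , id , λ _ ()
      go (c ∷ cs) with go cs
      ... | es , M′ , W′ , ext , max
        with E? c ×-dec ¬? (Covered? es (proj₁ (ends G c)) ⊎-dec Covered? es (proj₂ (ends G c)))
      ... | yes (Ec , ¬cov) = c ∷ es , All.tabulate free ∷ M′ , Ec ∷ W′ , there ∘ ext ,
          λ { f (here refl) _ → _ , inj₁ refl , c , here refl , inj₁ refl
            ; f (there f∈) Ef → let (v , vf , g , g∈ , vg) = max f f∈ Ef in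
                v , vf , g , there g∈ , vg }
        where
        free : ∀ {g} → g ∈ˡ es → Disjoint c g
        free g∈ v (inj₁ refl) vg = ¬cov (inj₁ (_ , g∈ , vg))
        free g∈ v (inj₂ refl) vg = ¬cov (inj₂ (_ , g∈ , vg))
      ... | no ¬new = es , M′ , W′ , ext , λ
          { f (here refl) Ef → cover Ef (decidable-stable
              (Covered? es (proj₁ (ends G f)) ⊎-dec Covered? es (proj₂ (ends G f)))
                                  (λ ¬cov → ¬new (Ef , ¬cov)))
          ; f (there f∈) Ef → max f f∈ Ef }
        where
        cover : E c → Covered es (proj₁ (ends G c)) ⊎ Covered es (proj₂ (ends G c)) →
          ∃ λ v → Incident G v c × Covered es v
        cover _ (inj₁ cov) = _ , inj₁ refl , cov
        cover _ (inj₂ cov) = _ , inj₂ refl , cov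
    ... | es , M′ , W′ , ext , max = record
      { edges = es ; matching = M′ ; within = W′ ; extends = ext
      ; maximal = λ f → max f (∈-allFin f) }

-- Intended reading: `A j` and `B j` are the vertices read before and after time `j`, and `O` is one
-- class of edges. The hypothesis `jump` reflects that an edge of the program carries at most one
-- variable.
module Layout (G : Graph)
  {O : Fin (m G) → Set} (O? : ∀ f → Dec (O f))
  {A B : ℕ → Fin (n G) → Set} (A? : ∀ j v → Dec (A j v)) (B? : ∀ j v → Dec (B j v))
  (A-mono : ∀ j {v} → A j v → A (suc j) v)
  (B-anti : ∀ j {v} → B (suc j) v → B j v)
  (A∩B : ∀ j {v} → A j v → ¬ B j v)
  (jump : ∀ j {u v} → u ≢ v → B j u → B j v → A (suc j) u → ¬ A (suc j) v)
  (L : ℕ) (B-start : ∀ v → B 0 v) (B-end : ∀ v → ¬ B L v)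
  where

  Crossing : ℕ → Fin (m G) → Set
  Crossing j f = O f × (∃ λ v → Incident G v f × ¬ A j v) × (∃ λ v → Incident G v f × ¬ B j v)

  abstract
    Crossing? : ∀ j f → Dec (Crossing j f)
    Crossing? j f = O? f
      ×-dec Fin.any? (λ v → Incident? G v f ×-dec ¬? (A? j v))
      ×-dec Fin.any? (λ v → Incident? G v f ×-dec ¬? (B? j v))

  kept : ∀ {j} → ∀ {fs} → MaximalExtension G (Crossing j) fs → List (Fin (m G))
  kept {j} S = filter (Crossing? (suc j)) (MaximalExtension.edges S)

  -- The matching at time j + 1 keeps the edges at time j that still cross.
  next : ∀ {j fs} (S : MaximalExtension G (Crossing j) fs) →
    MaximalExtension G (Crossing (suc j)) (kept S)
  next {j} S = extend G (Crossing? (suc j)) (kept S)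
    (AllPairs.filter⁺ (Crossing? (suc j)) (MaximalExtension.matching S))
    (All.all-filter (Crossing? (suc j)) (MaximalExtension.edges S))

  abstract
    state : ∀ j → ∃ λ fs → MaximalExtension G (Crossing j) fs
    state zero = [] , extend G (Crossing? 0) [] [] []
    state (suc j) = kept (proj₂ (state j)) , next (proj₂ (state j))

    mate : ℕ → List (Fin (m G))
    mate j = MaximalExtension.edges (proj₂ (state j))

    mate-matching : ∀ j → Matching G (mate j)
    mate-matching j = MaximalExtension.matching (proj₂ (state j))

    mate-crossing : ∀ j → All (Crossing j) (mate j)
    mate-crossing j = MaximalExtension.within (proj₂ (state j))

    mate-maximal : ∀ j f → Crossing j f → ∃ λ v → Incident G v f × Covered G (mate j) v
    mate-maximal j = MaximalExtension.maximal (proj₂ (state j))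

    mate-kept : ∀ j {f} → f ∈ˡ mate j → Crossing (suc j) f → f ∈ˡ mate (suc j)
    mate-kept j f∈ c = MaximalExtension.extends (next (proj₂ (state j))) (∈-filter⁺ (Crossing? (suc j)) f∈ c)

  C : ℕ → Fin (n G) → Set
  C j = Covered G (mate j)

  C? : ∀ j v → Dec (C j v)
  C? j = Covered? G (mate j)

  -- As long as `v` is outside `A`, its matching edge keeps crossing, since the end outside `B`
  -- never returns to `B`; an edge that still crosses is kept.
  uncovered⇒A : ∀ j {v} → C j v → ¬ C (suc j) v → A (suc j) v
  uncovered⇒A j {v} (f , f∈ , vf) ¬c = decidable-stable (A? (suc j) v) λ ¬a →
    let (o , _ , u , uf , ¬b) = All.lookup (mate-crossing j) f∈ in
    ¬c (f , mate-kept j f∈ (o , (v , vf , ¬a) , (u , uf , ¬b ∘ B-anti j)) , vf)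

  -- A neighbour w of v that is not yet in A was matched before and hence still is.
  uncovered-step : ∀ j {v} → A j v × ¬ C j v → A (suc j) v × ¬ C (suc j) v
  uncovered-step j {v} (a , ¬c) = A-mono j a , λ { (f , f∈ , vf) → rematched f f∈ vf }
    where
    rematched : ∀ f → f ∈ˡ mate (suc j) → ¬ Incident G v f
    rematched f f∈ vf with All.lookup (mate-crossing (suc j)) f∈
    ... | o , (w , wf , ¬a) , _
      with mate-maximal j f (o , (w , wf , ¬a ∘ A-mono j) , (v , vf , A∩B j a))
    ...   | x , xf , x∈C with third-incident G {f} xf vf wf (λ { refl → ¬a (A-mono j a) })
    ...     | inj₁ refl = ¬c x∈C
    ...     | inj₂ refl with x∈C
    ...       | g , g∈ , wg with All.lookup (mate-crossing j) g∈
    ...         | _ , _ , u , ug , ¬b with matching-unique G (mate-matching (suc j)) f∈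
                    (mate-kept j g∈ (proj₁ (All.lookup (mate-crossing j) g∈) , (w , wg , ¬a) , (u , ug , ¬b ∘ B-anti j))) wf wg
    ...           | refl = ¬c (g , g∈ , vf)

  uncovered-forever : ∀ {j l v} → j ≤ l → A j v → ¬ C j v → ¬ C l v
  uncovered-forever j≤l a ¬c = proj₂ (iterate (λ j → uncovered-step j) j≤l (a , ¬c))

  -- A vertex that loses its cover is already in `A`, and an uncovered vertex of `A` is never
  -- covered again.
  C-interval : ∀ {i j l v} → i ≤ j → j ≤ l → C i v → C l v → C j v
  C-interval {v = v} i≤j j≤l ci cl = decidable-stable (C? _ v) λ ¬cj →
    let (s , _ , s<j , cs , ¬cs) = lastTrue (λ s → C? s v) i≤j ci ¬cj
    in uncovered-forever (ℕ.≤-trans s<j j≤l) (uncovered⇒A s cs ¬cs) ¬cs cl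

  NeverC : Fin (n G) → Set
  NeverC v = ∀ (i : Fin (suc L)) → ¬ C (toℕ i) v

  abstract
    NeverC? : ∀ v → Dec (NeverC v)
    NeverC? v = Fin.all? λ i → ¬? (C? (toℕ i) v)

  sometimeC : ∀ {v} → ¬ NeverC v → ∃ λ i → i ≤ L × C i v
  sometimeC {v} ¬nev with Fin.¬∀⟶∃¬ (suc L) (λ i → ¬ C (toℕ i) v) (λ i → ¬? (C? (toℕ i) v)) ¬nev
  ... | i , ¬¬c = toℕ i , ℕ.≤-pred (Fin.toℕ<n i) , decidable-stable (C? _ v) ¬¬c

  -- This moment gives a never covered vertex its only bag. As `pred 0` is 0, nothing leaves at time
  -- 0.
  Leaves : ℕ → Fin (n G) → Set
  Leaves j v = B (pred j) v × ¬ B j v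

  Leaves-once : ∀ {i j v} → i < j → Leaves i v → ¬ Leaves j v
  Leaves-once {v = v} (s≤s i≤j) (_ , ¬b) (b , _) =
    iterate {P = λ j → ¬ B j v} (λ j ¬b → ¬b ∘ B-anti j) i≤j ¬b b

  Leaves-unique : ∀ {i j v} → Leaves i v → Leaves j v → i ≡ j
  Leaves-unique {i} {j} p q with ℕ.<-cmp i j
  ... | tri< i<j _ _ = ⊥-elim (Leaves-once i<j p q)
  ... | tri≈ _ eq _ = eq
  ... | tri> _ _ j<i = ⊥-elim (Leaves-once j<i q p)

  Private : ℕ → Fin (n G) → Set
  Private j v = Leaves j v × NeverC v

  abstract
    Private? : ∀ j v → Dec (Private j v)
    Private? j v = (B? (pred j) v ×-dec ¬? (B? j v)) ×-dec NeverC? v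

  private-list : ℕ → Fin (n G) → List (Fin (n G))
  private-list j v = onlyIf (Private? j v) v

  -- The second index separates vertices that leave `B` simultaneously, so a bag has at most one
  -- private vertex. Two consecutive covers are joined because one end of an edge may lose its cover
  -- just when the other end gains it.
  bagList : ℕ → Fin (n G) → List (Fin (n G))
  bagList j v = private-list j v ++ vertices G (mate (pred j)) ++ vertices G (mate j)

  ∈-bag-private : ∀ {j v} → Private j v → v ∈ˡ bagList j v
  ∈-bag-private {j} {v} p = ∈-++⁺ˡ (∈-onlyIf⁺ (Private? j v) p)

  ∈-bag-prev : ∀ {j v u} → C (pred j) u → u ∈ˡ bagList j v
  ∈-bag-prev {j} {v} c = ∈-++⁺ʳ (private-list j v) (∈-++⁺ˡ (∈-vertices⁺ G c))

  ∈-bag-now : ∀ {j v u} → C j u → u ∈ˡ bagList j v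
  ∈-bag-now {j} {v} c = ∈-++⁺ʳ (private-list j v) (∈-++⁺ʳ (vertices G (mate (pred j))) (∈-vertices⁺ G c))

  Near : ℕ → Fin (n G) → Set
  Near j u = C (pred j) u ⊎ C j u

  ∈-bag-near : ∀ {j v u} → Near j u → u ∈ˡ bagList j v
  ∈-bag-near {j} = [ ∈-bag-prev {j} , ∈-bag-now {j} ]′

  ∈-bag⁻ : ∀ j v {u} → u ∈ˡ bagList j v → (u ≡ v × Private j u) ⊎ Near j u
  ∈-bag⁻ j v u∈ with ∈-++⁻ (private-list j v) u∈
  ... | inj₂ u∈ with ∈-++⁻ (vertices G (mate (pred j))) u∈
  ...   | inj₁ u∈ = inj₂ (inj₁ (∈-vertices⁻ G _ u∈))
  ...   | inj₂ u∈ = inj₂ (inj₂ (∈-vertices⁻ G _ u∈))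
  ∈-bag⁻ j v _ | inj₁ u∈ with ∈-onlyIf⁻ (Private? j v) u∈
  ...   | refl , p = inj₁ (refl , p)

  near⇒¬never : ∀ {j u} → j ≤ L → Near j u → ¬ NeverC u
  near⇒¬never {j} {u} j≤L near nev = [ absurd (ℕ.≤-trans ℕ.pred[n]≤n j≤L) , absurd j≤L ]′ near
    where
    absurd : ∀ {i} → i ≤ L → ¬ C i u
    absurd i≤L c = nev (fromℕ< (s≤s i≤L)) (subst (λ i → C i u) (sym (Fin.toℕ-fromℕ< (s≤s i≤L))) c)

  Near-interval : ∀ {i j l u} → i ≤ j → j ≤ l → Near i u → Near l u → Near j u
  Near-interval i≤j j≤l (inj₁ c) (inj₁ d) =
    inj₁ (C-interval (ℕ.pred-mono-≤ i≤j) (ℕ.pred-mono-≤ j≤l) c d)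
  Near-interval i≤j j≤l (inj₁ c) (inj₂ d) = inj₂ (C-interval (ℕ.≤-trans ℕ.pred[n]≤n i≤j) j≤l c d)
  Near-interval i≤j j≤l (inj₂ c) (inj₂ d) = inj₂ (C-interval i≤j j≤l c d)
  Near-interval {i} {j} i≤j j≤l (inj₂ c) (inj₁ d) with ℕ.m≤n⇒m<n∨m≡n i≤j
  ... | inj₁ (s≤s i≤j′) = inj₁ (C-interval i≤j′ (ℕ.pred-mono-≤ j≤l) c d)
  ... | inj₂ refl = inj₂ c

  leaving : ∀ v → ∃ λ j → j < L × Leaves (suc j) v
  leaving v with lastTrue (λ j → B? j v) (z≤n {L}) (B-start v) (B-end v)
  ... | j , _ , j<L , b , ¬b = j , j<L , b , ¬b

  vertex-bag : ∀ v → ∃₂ λ j w → j ≤ L × v ∈ˡ bagList j w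
  vertex-bag v with NeverC? v | leaving v
  ... | yes nev | j , j<L , lv = suc j , v , j<L , ∈-bag-private {suc j} (lv , nev)
  ... | no ¬nev | _ with sometimeC ¬nev
  ...   | i , i≤L , c = i , v , i≤L , ∈-bag-now {i} c

  -- Whether or not u has left B when v does, the edge crosses at one of the two moments.
  never-bag : ∀ {f u v} → O f → Incident G u f → Incident G v f → u ≢ v → NeverC v →
    ∃₂ λ j w → j ≤ L × u ∈ˡ bagList j w × v ∈ˡ bagList j w
  never-bag {f} {u} {v} o uf vf u≢v nev with leaving v
  ... | j , j<L , b , ¬b = suc j , v , j<L , ∈-bag-near {suc j} near , ∈-bag-private {suc j} ((b , ¬b) , nev)
    where
    covered : ∀ {i} → i ≤ L → Crossing i f → C i u
    covered {i} i≤L c with mate-maximal i f c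
    ... | x , xf , cx with third-incident G {f} xf uf vf u≢v
    ... | inj₁ refl = cx
    ... | inj₂ refl = ⊥-elim (near⇒¬never {i} i≤L (inj₂ cx) nev)
    near : Near (suc j) u
    near with B? j u | A? (suc j) u | A? (suc j) v
    ... | no ¬bu | _ | _ = inj₁ (covered (ℕ.<⇒≤ j<L) (o , (v , vf , λ a → A∩B j a b) , (u , uf , ¬bu)))
    ... | yes bu | no ¬au | _ = inj₂ (covered j<L (o , (u , uf , ¬au) , (v , vf , ¬b)))
    ... | yes bu | _ | no ¬av = inj₂ (covered j<L (o , (v , vf , ¬av) , (v , vf , ¬b)))
    ... | yes bu | yes au | yes av = ⊥-elim (jump j u≢v bu b au av)

  -- Let `u` lose its cover between `s` and `s + 1`. If `v` is covered at `s + 1`, the bag of that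
  -- time holds both. Otherwise `v` is in `A` and never covered again, or the edge crosses at
  -- `s + 1` without a covered end, against maximality.
  meet : ∀ {f u v i j} → O f → Incident G u f → Incident G v f → u ≢ v →
    i ≤ j → j ≤ L → C i u → C j v → ∃ λ l → l ≤ L × Near l u × Near l v
  meet {f} {u} {v} {i} {j} o uf vf u≢v i≤j j≤L cu cv with C? j u
  ... | yes cu′ = j , j≤L , inj₂ cu′ , inj₂ cv
  ... | no ¬cu with lastTrue (λ s → C? s u) i≤j cu ¬cu
  ... | s , _ , s<j , cs , ¬cs with C? (suc s) v
  ...   | yes cv′ = suc s , ℕ.≤-trans s<j j≤L , inj₁ cs , inj₂ cv′
  ...   | no ¬cv with A? (suc s) v
  ...     | yes av = ⊥-elim (uncovered-forever s<j av ¬cv cv)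
  ...     | no ¬av with mate-maximal (suc s) f
                      (o , (v , vf , ¬av) , (u , uf , A∩B (suc s) (uncovered⇒A s cs ¬cs)))
  ...       | x , xf , cx with third-incident G {f} xf uf vf u≢v
  ...         | inj₁ refl = ⊥-elim (¬cs cx)
  ...         | inj₂ refl = ⊥-elim (¬cv cx)

  edge-bag : ∀ {f u v} → O f → Incident G u f → Incident G v f → u ≢ v →
    ∃₂ λ j w → j ≤ L × u ∈ˡ bagList j w × v ∈ˡ bagList j w
  edge-bag {f} {u} {v} o uf vf u≢v with NeverC? u | NeverC? v
  ... | _ | yes nev = never-bag o uf vf u≢v nev
  ... | yes nev | _ with never-bag o vf uf (u≢v ∘ sym) nev
  ...   | j , w , j≤L , v∈ , u∈ = j , w , j≤L , u∈ , v∈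
  edge-bag {f} {u} {v} o uf vf u≢v | no su | no sv with sometimeC su | sometimeC sv
  ... | i , i≤L , cu | j , j≤L , cv with ℕ.≤-total i j
  ...   | inj₁ i≤j with meet o uf vf u≢v i≤j j≤L cu cv
  ...     | l , l≤L , nu , nv = l , u , l≤L , ∈-bag-near {l} nu , ∈-bag-near {l} nv
  edge-bag {f} {u} {v} o uf vf u≢v | no su | no sv | i , i≤L , cu | j , j≤L , cv | inj₂ j≤i
    with meet o vf uf (u≢v ∘ sym) j≤i i≤L cv cu
  ... | l , l≤L , nv , nu = l , u , l≤L , ∈-bag-near {l} nu , ∈-bag-near {l} nv

  -- Each class receives all vertices, so covering `G` is a question about edges only.
  subgraph : SubgraphOf G
  subgraph = record { VS = ⊤ˢ ; ES = comprehension O? ; closed = λ _ _ → Subset.∈⊤ , Subset.∈⊤ }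

  bag-at : Fin (suc L) × Fin (n G) → Subset (n G)
  bag-at (j , v) = fromList (bagList (toℕ j) v)

  -- Pairs of a time and a vertex are numbered lexicographically, so the order of the bags refines
  -- time.
  index : ∀ {j} → j ≤ L → Fin (n G) → Fin (suc L * n G)
  index j≤L w = combine (fromℕ< (s≤s j≤L)) w

  ∈-index : ∀ {j u} (j≤L : j ≤ L) w → u ∈ˡ bagList j w → u ∈ˢ bag-at (remQuot {suc L} (n G) (index j≤L w))
  ∈-index {j} {u} j≤L w u∈ =
    subst (λ i → u ∈ˢ bag-at i) (sym (Fin.remQuot-combine (fromℕ< (s≤s j≤L)) w))
      (∈-fromList⁺ {xs = bagList (toℕ (fromℕ< (s≤s j≤L))) w}
        (subst (λ i → u ∈ˡ bagList i w) (sym (Fin.toℕ-fromℕ< (s≤s j≤L))) u∈))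

  quotient-mono : ∀ {a b} {i j : Fin (a * b)} → i ≤ᶠ j → quotient {a} b i ≤ᶠ quotient {a} b j
  quotient-mono {a} {b} {i} {j} i≤j = ℕ.≮⇒≥ λ q<p → ℕ.<⇒≱
    (subst₂ (λ x y → toℕ x < toℕ y) (Fin.combine-remQuot {a} b j) (Fin.combine-remQuot {a} b i)
      (Fin.combine-monoˡ-< (proj₂ (remQuot {a} b j)) (proj₂ (remQuot {a} b i)) q<p)) i≤j

  bags-interval : ∀ i j l v → i ≤ᶠ j → j ≤ᶠ l → v ∈ˢ bag-at (remQuot {suc L} (n G) i) →
    v ∈ˢ bag-at (remQuot {suc L} (n G) l) → v ∈ˢ bag-at (remQuot {suc L} (n G) j)
  bags-interval i j l v i≤j j≤l v∈i v∈l
    with ∈-bag⁻ (toℕ (quotient {suc L} (n G) i)) _ (∈-fromList⁻ _ v∈i)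
       | ∈-bag⁻ (toℕ (quotient {suc L} (n G) l)) _ (∈-fromList⁻ _ v∈l)
  ... | inj₂ near | inj₂ near′ =
    ∈-fromList⁺ (∈-bag-near {toℕ (quotient {suc L} (n G) j)}
      (Near-interval (quotient-mono {suc L} i≤j) (quotient-mono {suc L} j≤l) near near′))
  ... | inj₁ (_ , _ , nev) | inj₂ near = ⊥-elim (near⇒¬never (Fin.toℕ≤pred[n] (quotient {suc L} (n G) l)) near nev)
  ... | inj₂ near | inj₁ (_ , _ , nev) = ⊥-elim (near⇒¬never (Fin.toℕ≤pred[n] (quotient {suc L} (n G) i)) near nev)
  -- Both memberships are private: the time is fixed by leaving `B` once and the second index is the
  -- vertex itself, so the two bags coincide.
  ... | inj₁ (refl , lv , _) | inj₁ (eq , lv′ , _) =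
    subst (λ k → v ∈ˢ bag-at (remQuot {suc L} (n G) k)) (Fin.≤-antisym i≤j (subst (j ≤ᶠ_) (sym i≡l) j≤l)) v∈i
    where
    i≡l : i ≡ l
    i≡l = trans (sym (Fin.combine-remQuot {suc L} (n G) i)) (trans
      (cong₂ combine (Fin.toℕ-injective (Leaves-unique lv lv′)) eq) (Fin.combine-remQuot {suc L} (n G) l))

  module _ {t w : ℕ} (bound : ∀ j fs → Matching G fs → All (Crossing j) fs → length fs ≤ t)
    (4t≤w : 4 * t ≤ w) where

    -- One private vertex and two covers of at most `2 * t` vertices each.
    bag-size : ∀ j v → length (bagList j v) ≤ suc w
    bag-size j v = begin
      length (bagList j v) ≡⟨ List.length-++ (private-list j v) ⟩
      length (private-list j v) + length (vertices G (mate (pred j)) ++ vertices G (mate j))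
        ≡⟨ cong (length (private-list j v) +_) (List.length-++ (vertices G (mate (pred j)))) ⟩
      length (private-list j v) + (length (vertices G (mate (pred j))) + length (vertices G (mate j)))
        ≤⟨ ℕ.+-mono-≤ (length-onlyIf (Private? j v)) (ℕ.+-mono-≤ (mate-size (pred j)) (mate-size j)) ⟩
      1 + (2 * t + 2 * t)
        ≡⟨ cong suc (sym (ℕ.*-distribʳ-+ t 2 2)) ⟩
      suc (4 * t) ≤⟨ s≤s 4t≤w ⟩
      suc w ∎
      where
      open ℕ.≤-Reasoning
      mate-size : ∀ i → length (vertices G (mate i)) ≤ 2 * t
      mate-size i = ℕ.≤-trans (ℕ.≤-reflexive (length-vertices G (mate i)))
        (ℕ.*-monoʳ-≤ 2 (bound i _ (mate-matching i) (mate-crossing i)))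

    pathDecomposition : PathDecomposition G subgraph w
    pathDecomposition = record
      { r = suc L * n G
      ; bag = λ i → bag-at (remQuot {suc L} (n G) i)
      ; bag⊆ = λ _ _ → Subset.∈⊤
      ; vertexCover = λ v _ → let (j , u , j≤L , v∈) = vertex-bag v in index j≤L u , ∈-index j≤L u v∈
      ; edgeCover = λ f f∈ →
          let (j , u , j≤L , p , q) = edge-bag {f} (∈-comprehension⁻ O? f∈) (inj₁ refl) (inj₂ refl) (loopless G f)
          in index j≤L u , ∈-index j≤L u p , ∈-index j≤L u q
      ; interpolation = bags-interval
      ; width≤ = λ i → let (j , v) = remQuot {suc L} (n G) i in
          ℕ.≤-trans (∣fromList∣≤length (bagList (toℕ j) v)) (bag-size (toℕ j) v)
      }

-- Assignments escaping few families of independent 2-clauses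

sumAll : ∀ n → (Vec Bool n → ℕ) → ℕ
sumAll zero f = f []
sumAll (suc n) f = sumAll n (f ∘ (true ∷_)) + sumAll n (f ∘ (false ∷_))

sumAll-cong : ∀ n {f g} → (∀ U → f U ≡ g U) → sumAll n f ≡ sumAll n g
sumAll-cong zero f≗g = f≗g []
sumAll-cong (suc n) f≗g = cong₂ _+_ (sumAll-cong n (f≗g ∘ (true ∷_))) (sumAll-cong n (f≗g ∘ (false ∷_)))

sumAll-+ : ∀ n f g → sumAll n (λ U → f U + g U) ≡ sumAll n f + sumAll n g
sumAll-+ zero f g = refl
sumAll-+ (suc n) f g
  rewrite sumAll-+ n (f ∘ (true ∷_)) (g ∘ (true ∷_)) | sumAll-+ n (f ∘ (false ∷_)) (g ∘ (false ∷_)) =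
  interchange (sumAll n (f ∘ (true ∷_))) (sumAll n (g ∘ (true ∷_))) _ _

sumAll-* : ∀ n c f → sumAll n (λ U → c * f U) ≡ c * sumAll n f
sumAll-* zero c f = refl
sumAll-* (suc n) c f
  rewrite sumAll-* n c (f ∘ (true ∷_)) | sumAll-* n c (f ∘ (false ∷_)) = sym (ℕ.*-distribˡ-+ c _ _)

sumAll-1 : ∀ n → sumAll n (λ _ → 1) ≡ 2 ^ n
sumAll-1 zero = refl
sumAll-1 (suc n) rewrite sumAll-1 n = cong (2 ^ n +_) (sym (ℕ.+-identityʳ (2 ^ n)))

sumAll-0 : ∀ n → sumAll n (λ _ → 0) ≡ 0
sumAll-0 zero = refl
sumAll-0 (suc n) rewrite sumAll-0 n = refl

-- Every vector arises from exactly two `U`, those that agree with it off `i`.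
sumAll-split : ∀ n (i : Fin n) f →
  sumAll n (λ U → f (U [ i ]≔ true) + f (U [ i ]≔ false)) ≡ 2 * sumAll n f
sumAll-split (suc n) zero f rewrite sumAll-+ n (f ∘ (true ∷_)) (f ∘ (false ∷_)) =
  cong (sumAll (suc n) f +_) (sym (ℕ.+-identityʳ _))
sumAll-split (suc n) (suc i) f
  rewrite sumAll-split n i (f ∘ (true ∷_)) | sumAll-split n i (f ∘ (false ∷_)) =
  sym (ℕ.*-distribˡ-+ 2 (sumAll n (f ∘ (true ∷_))) _)

-- Averaging: one of the two halves of the cube has mean below 1, and the search descends into it.
sumAll<2^n⇒zero : ∀ n f → sumAll n f < 2 ^ n → ∃ λ U → f U ≡ 0
sumAll<2^n⇒zero zero f f<1 = [] , ℕ.n<1⇒n≡0 f<1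
sumAll<2^n⇒zero (suc n) f lt
  with sumAll n (f ∘ (true ∷_)) ℕ.<? 2 ^ n | sumAll n (f ∘ (false ∷_)) ℕ.<? 2 ^ n
... | yes p | _ = let (U , eq) = sumAll<2^n⇒zero n _ p in true ∷ U , eq
... | _ | yes p = let (U , eq) = sumAll<2^n⇒zero n _ p in false ∷ U , eq
... | no p | no q = ⊥-elim (ℕ.<⇒≱ lt
  (ℕ.+-mono-≤ (ℕ.≮⇒≥ p) (ℕ.≤-trans (ℕ.≤-reflexive (ℕ.+-identityʳ (2 ^ n))) (ℕ.≮⇒≥ q))))

sumFin : ∀ K → (Fin K → ℕ) → ℕ
sumFin zero f = 0
sumFin (suc K) f = f zero + sumFin K (f ∘ suc)

sumFin≡0 : ∀ K f → sumFin K f ≡ 0 → ∀ i → f i ≡ 0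
sumFin≡0 (suc K) f eq zero = ℕ.m+n≡0⇒m≡0 (f zero) eq
sumFin≡0 (suc K) f eq (suc i) = sumFin≡0 K (f ∘ suc) (ℕ.m+n≡0⇒n≡0 (f zero) eq) i

-- The union bound, with the denominator `q` cleared.
sum-swap-≤ : ∀ n K {q c} (f : Fin K → Vec Bool n → ℕ) → (∀ i → q * sumAll n (f i) ≤ c) →
  q * sumAll n (λ U → sumFin K (λ i → f i U)) ≤ K * c
sum-swap-≤ n zero {q} f bound rewrite sumAll-0 n | ℕ.*-zeroʳ q = z≤n
sum-swap-≤ n (suc K) {q} {c} f bound
  rewrite sumAll-+ n (f zero) (λ U → sumFin K (λ i → f (suc i) U))
        | ℕ.*-distribˡ-+ q (sumAll n (f zero)) (sumAll n (λ U → sumFin K (λ i → f (suc i) U))) =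
  ℕ.+-mono-≤ (bound zero) (sum-swap-≤ n K {q} (f ∘ suc) (bound ∘ suc))

module _ {n : ℕ} where

  Pair : Set
  Pair = Fin n × Fin n

  -- The implication runs from the second component to the first.
  implies : Vec Bool n → Pair → Bool
  implies U (a , b) = lookup U a ∨ not (lookup U b)

  Implies : Vec Bool n → Pair → Set
  Implies U p = implies U p ≡ true

  Apart : Pair → Pair → Set
  Apart (a , b) (c , d) = (a ≢ c × a ≢ d) × (b ≢ c × b ≢ d)

  Independent : List Pair → Set
  Independent ps = AllPairs Apart ps × All (λ (a , b) → a ≢ b) ps

  bit : Bool → ℕ
  bit true = 1
  bit false = 0

  indicator : List Pair → Vec Bool n → ℕ
  indicator [] U = 1
  indicator (p ∷ ps) U = bit (implies U p) * indicator ps U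

  indicator≢0 : ∀ {ps U} → All (Implies U) ps → indicator ps U ≢ 0
  indicator≢0 {p ∷ ps} {U} (ok ∷ oks) eq rewrite ok | ℕ.+-identityʳ (indicator ps U) = indicator≢0 oks eq

  indicator-update : ∀ {ps i U x} → All (λ (a , b) → i ≢ a × i ≢ b) ps →
    indicator ps (U [ i ]≔ x) ≡ indicator ps U
  indicator-update [] = refl
  indicator-update {(a , b) ∷ _} {i} {U} {x} ((i≢a , i≢b) ∷ rest)
    rewrite lookup∘update′ (i≢a ∘ sym) U x | lookup∘update′ (i≢b ∘ sym) U x =
    cong (bit (lookup U a ∨ not (lookup U b)) *_) (indicator-update {U = U} rest)

  -- Of the four values of (U a , U b) exactly three satisfy the first clause, and the others do not see a and b.
  sum-indicator-∷ : ∀ {p ps} → Independent (p ∷ ps) →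
    4 * sumAll n (indicator (p ∷ ps)) ≡ 3 * sumAll n (indicator ps)
  sum-indicator-∷ {p@(a , b)} {ps} (apart ∷ _ , a≢b ∷ _) = begin
    4 * sumAll n F ≡⟨ ℕ.*-assoc 2 2 (sumAll n F) ⟩
    2 * (2 * sumAll n F) ≡⟨ cong (2 *_) (sym (sumAll-split n b F)) ⟩
    2 * sumAll n F₁ ≡⟨ sym (sumAll-split n a F₁) ⟩
    sumAll n (λ U → F₁ (U [ a ]≔ true) + F₁ (U [ a ]≔ false)) ≡⟨ sumAll-cong n pointwise ⟩
    sumAll n (λ U → 3 * indicator ps U) ≡⟨ sumAll-* n 3 (indicator ps) ⟩
    3 * sumAll n (indicator ps) ∎
    where
    open ≡-Reasoning
    F F₁ : Vec Bool n → ℕ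
    F = indicator (p ∷ ps)
    F₁ U = F (U [ b ]≔ true) + F (U [ b ]≔ false)
    value : ∀ U x y → F ((U [ a ]≔ x) [ b ]≔ y) ≡ bit (x ∨ not y) * indicator ps U
    value U x y rewrite lookup∘update′ a≢b (U [ a ]≔ x) y | lookup∘update a U x
      | lookup∘update b (U [ a ]≔ x) y =
      cong (bit (x ∨ not y) *_) (trans (indicator-update {U = U [ a ]≔ x} (All.map proj₂ apart))
                                       (indicator-update {U = U} (All.map proj₁ apart)))
    three : ∀ w → (1 * w + 1 * w) + (0 * w + 1 * w) ≡ 3 * w
    three = solve-∀
    pointwise : ∀ U → F₁ (U [ a ]≔ true) + F₁ (U [ a ]≔ false) ≡ 3 * indicator ps U
    pointwise U rewrite value U true true | value U true false | value U false true | value U false false =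
      three (indicator ps U)

  sum-indicator : ∀ {ps} → Independent ps → 4 ^ length ps * sumAll n (indicator ps) ≡ 3 ^ length ps * 2 ^ n
  sum-indicator {[]} _ = cong (1 *_) (sumAll-1 n)
  sum-indicator {p ∷ ps} ind@(_ ∷ apart , _ ∷ proper) = begin
    4 * 4 ^ l * S′ ≡⟨ swap 4 (4 ^ l) S′ ⟩
    4 ^ l * (4 * S′) ≡⟨ cong (4 ^ l *_) (sum-indicator-∷ ind) ⟩
    4 ^ l * (3 * S) ≡⟨ sym (swap 3 (4 ^ l) S) ⟩
    3 * 4 ^ l * S ≡⟨ ℕ.*-assoc 3 (4 ^ l) S ⟩
    3 * (4 ^ l * S) ≡⟨ cong (3 *_) (sum-indicator (apart , proper)) ⟩
    3 * (3 ^ l * 2 ^ n) ≡⟨ sym (ℕ.*-assoc 3 (3 ^ l) (2 ^ n)) ⟩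
    3 * 3 ^ l * 2 ^ n ∎
    where
    open ≡-Reasoning
    l S S′ : ℕ
    l = length ps
    S = sumAll n (indicator ps)
    S′ = sumAll n (indicator (p ∷ ps))
    swap : ∀ x y z → x * y * z ≡ y * (x * z)
    swap = solve-∀

  Fooled : ℕ → (Vec Bool n → Set) → Set
  Fooled t Q = ∃ λ ps → length ps ≡ t × Independent ps × (∀ U → Q U → All (Implies U) ps)

  -- Each fooled predicate holds for at most a (3/4)^t fraction of all U; the union bound leaves some U.
  avoid-fooled : ∀ {K t} (Q : Fin K → Vec Bool n → Set) → (∀ i → Dec (Fooled t (Q i))) →
    K * 3 ^ t < 4 ^ t → ∃ λ U → ∀ i → Q i U → ¬ Fooled t (Q i)
  avoid-fooled {K} {t} Q fooled? small =
    let (U , eq) = sumAll<2^n⇒zero n total total< in U , λ i → spared i U (sumFin≡0 K _ eq i)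
    where
    cost : ∀ {Q} → Dec (Fooled t Q) → Vec Bool n → ℕ
    cost (yes (ps , _)) = indicator ps
    cost (no _) _ = 0
    total : Vec Bool n → ℕ
    total U = sumFin K λ i → cost (fooled? i) U
    cost≤ : ∀ {Q} (d : Dec (Fooled t Q)) → 4 ^ t * sumAll n (cost d) ≤ 3 ^ t * 2 ^ n
    cost≤ (yes (ps , refl , ind , _)) = ℕ.≤-reflexive (sum-indicator ind)
    cost≤ (no _) rewrite sumAll-0 n | ℕ.*-zeroʳ (4 ^ t) = z≤n
    spared : ∀ i U → cost (fooled? i) U ≡ 0 → Q i U → ¬ Fooled t (Q i)
    spared i U eq q f with fooled? i
    ... | yes (ps , _ , _ , forced) = indicator≢0 (forced U q) eq
    ... | no ¬f = ¬f f
    total< : sumAll n total < 2 ^ n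
    total< = ℕ.*-cancelˡ-< (4 ^ t) _ _ (begin-strict
      4 ^ t * sumAll n total ≤⟨ sum-swap-≤ n K {4 ^ t} (λ i → cost (fooled? i)) (λ i → cost≤ (fooled? i)) ⟩
      K * (3 ^ t * 2 ^ n) ≡⟨ sym (ℕ.*-assoc K (3 ^ t) (2 ^ n)) ⟩
      K * 3 ^ t * 2 ^ n <⟨ ℕ.*-monoˡ-< (2 ^ n) {{ℕ.m^n≢0 2 n}} small ⟩
      4 ^ t * 2 ^ n ∎)
      where open ℕ.≤-Reasoning

-- Walks and read-once segments of a branching program

-- Finite products commute with double negation, which permits classical case distinctions over a
-- finite index set whenever the goal is a negation.
¬¬-Fin : ∀ {n} {P : Fin n → Set} → (∀ i → ¬ ¬ P i) → ¬ ¬ (∀ i → P i)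
¬¬-Fin {zero} p k = k λ ()
¬¬-Fin {suc n} p k = p zero λ p₀ → ¬¬-Fin (p ∘ suc) λ ps → k λ { zero → p₀ ; (suc i) → ps i }

¬¬-Dec-Fin : ∀ {n} (P : Fin n → Set) → ¬ ¬ (∀ i → Dec (P i))
¬¬-Dec-Fin P = ¬¬-Fin λ _ → ¬¬-excluded-middle

++-split : ∀ {A : Set} (xs ps : List A) {ys qs} → xs ++ ys ≡ ps ++ qs →
  (∃ λ rs → ps ≡ xs ++ rs × ys ≡ rs ++ qs) ⊎ (∃ λ rs → xs ≡ ps ++ rs × qs ≡ rs ++ ys)
++-split [] ps eq = inj₁ (ps , refl , eq)
++-split (x ∷ xs) [] eq = inj₂ (x ∷ xs , refl , sym eq)
++-split (x ∷ xs) (p ∷ ps) eq with List.∷-injective eq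
... | refl , eq′ with ++-split xs ps eq′
...   | inj₁ (rs , refl , eq″) = inj₁ (rs , refl , eq″)
...   | inj₂ (rs , refl , eq″) = inj₂ (rs , refl , eq″)

module Walks {X : Set} (Z : NBP X) (_≟_ : DecidableEquality X) where

  E : Set
  E = Fin (M Z)

  var : E → Maybe X
  var e = Maybe.map litVar (label Z e)

  Occurs : X → List E → Set
  Occurs x = Any λ e → var e ≡ just x

  occ-++ : ∀ x xs ys → occ Z _≟_ x (xs ++ ys) ≡ occ Z _≟_ x xs + occ Z _≟_ x ys
  occ-++ x [] ys = refl
  occ-++ x (e ∷ xs) ys with label Z e
  ... | nothing = occ-++ x xs ys
  ... | just l with litVar l ≟ x
  ...   | yes _ = cong suc (occ-++ x xs ys)
  ...   | no _ = occ-++ x xs ys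

  Occurs⇒occ : ∀ {x es} → Occurs x es → 1 ≤ occ Z _≟_ x es
  Occurs⇒occ {x} {e ∷ es} (here v) with label Z e | v
  ... | just l | refl with litVar l ≟ x
  ...   | yes _ = s≤s z≤n
  ...   | no l≢x = ⊥-elim (l≢x refl)
  Occurs⇒occ {x} {e ∷ es} (there o) with label Z e
  ... | nothing = Occurs⇒occ o
  ... | just l with litVar l ≟ x
  ...   | yes _ = s≤s z≤n
  ...   | no _ = Occurs⇒occ o

  readOnce-++⇒¬both : ∀ {x} xs {ys} → ReadOnce Z _≟_ (xs ++ ys) → Occurs x xs → ¬ Occurs x ys
  readOnce-++⇒¬both {x} xs {ys} once p q = ℕ.<⇒≱ (s≤s (once x))
    (ℕ.≤-trans (ℕ.+-mono-≤ (Occurs⇒occ p) (Occurs⇒occ q)) (ℕ.≤-reflexive (sym (occ-++ x xs ys))))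

  readOnce-++ˡ : ∀ xs {ys} → ReadOnce Z _≟_ (xs ++ ys) → ReadOnce Z _≟_ xs
  readOnce-++ˡ xs {ys} once x = ℕ.≤-trans (ℕ.m≤m+n _ _) (ℕ.≤-trans (ℕ.≤-reflexive (sym (occ-++ x xs ys))) (once x))

  readOnce-++ʳ : ∀ xs {ys} → ReadOnce Z _≟_ (xs ++ ys) → ReadOnce Z _≟_ ys
  readOnce-++ʳ xs {ys} once x = ℕ.≤-trans (ℕ.m≤n+m _ _) (ℕ.≤-trans (ℕ.≤-reflexive (sym (occ-++ x xs ys))) (once x))

  -- Pieces may be empty, so this means at most `j` read-once pieces.
  Cov : ℕ → List E → Set
  Cov zero es = es ≡ []
  Cov (suc j) es = ∃₂ λ ps qs → es ≡ ps ++ qs × ReadOnce Z _≟_ ps × Cov j qs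

  Cov-suc : ∀ {j es} → Cov j es → Cov (suc j) es
  Cov-suc c = [] , _ , refl , (λ _ → z≤n) , c

  -- A piece that is cut leaves a read-once suffix, and a piece inside the removed prefix is
  -- replaced by an empty one.
  Cov-drop : ∀ j xs {ys} → Cov j (xs ++ ys) → Cov j ys
  Cov-drop zero xs eq = List.++-conicalʳ xs _ eq
  Cov-drop (suc j) xs (ps , qs , eq , once , c) with ++-split xs ps eq
  ... | inj₁ (rs , refl , refl) = rs , qs , refl , readOnce-++ʳ xs once , c
  ... | inj₂ (rs , refl , refl) = Cov-suc (Cov-drop j rs c)

  concat⇒Cov : ∀ {j} Ps → length Ps ≤ j → All (ReadOnce Z _≟_) Ps → Cov j (concat Ps)
  concat⇒Cov {zero} [] _ _ = refl
  concat⇒Cov {suc j} [] _ _ = Cov-suc (concat⇒Cov {j} [] z≤n [])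
  concat⇒Cov (P ∷ Ps) (s≤s le) (once ∷ onces) = P , concat Ps , refl , once , concat⇒Cov Ps le onces

  -- Walk e q es: the edges es follow e and end with the edge q.
  data Walk : E → E → List E → Set where
    []  : ∀ {e} → Walk e e []
    _∷_ : ∀ {e e′ q es} → tgt Z e ≡ src Z e′ → Walk e′ q es → Walk e q (e′ ∷ es)

  infixr 5 _++ʷ_
  _++ʷ_ : ∀ {e q r xs ys} → Walk e q xs → Walk q r ys → Walk e r (xs ++ ys)
  [] ++ʷ w = w
  (p ∷ v) ++ʷ w = p ∷ (v ++ʷ w)

  _++ᵖ_ : ∀ {e q v xs ys} → Walk e q xs → Path Z (tgt Z q) v ys → Path Z (tgt Z e) v (xs ++ ys)
  [] ++ᵖ p = p
  (eq ∷ w) ++ᵖ p = sym eq ∷ (w ++ᵖ p)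

  walk⇒path : ∀ {e q xs} → Walk e q xs → Path Z (tgt Z e) (tgt Z q) xs
  walk⇒path [] = []
  walk⇒path (eq ∷ w) = sym eq ∷ walk⇒path w

  closed-walk : ∀ {e xs} → Walk e e xs → xs ≡ []
  closed-walk {e} w = acyclic Z (tgt Z e) _ (walk⇒path w)

  unsnoc : ∀ {e q xs} → Walk e q xs →
    (xs ≡ [] × e ≡ q) ⊎ (∃₂ λ ys p → xs ≡ ys ++ q ∷ [] × Walk e p ys × tgt Z p ≡ src Z q)
  unsnoc [] = inj₁ (refl , refl)
  unsnoc {e} (_∷_ {e′ = e′} eq w) with unsnoc w
  ... | inj₁ (refl , refl) = inj₂ ([] , e , refl , [] , eq)
  ... | inj₂ (ys , p , refl , w′ , eq′) = inj₂ (e′ ∷ ys , p , refl , eq ∷ w′ , eq′)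

  walk-last : ∀ {e q xs} → Walk e q xs → ∃ λ zs → e ∷ xs ≡ zs ++ q ∷ []
  walk-last {e} w with unsnoc w
  ... | inj₁ (refl , refl) = [] , refl
  ... | inj₂ (ys , _ , refl , _) = e ∷ ys , refl

  Good : E → E → Set
  Good e q = ∀ xs → Walk e q xs → ReadOnce Z _≟_ (e ∷ xs)

  High : ℕ → E → Set
  High j e = ∃ λ R → Path Z (tgt Z e) (sink Z) R × ¬ Cov j (e ∷ R)

  -- The double negation is harmless: `Low` serves only to derive contradictions, and in this form
  -- it follows from the failure of `High`.
  Low : ℕ → E → Set
  Low j e = ∀ R → Path Z (tgt Z e) (sink Z) R → ¬ ¬ Cov j (e ∷ R)

  ¬High⇒Low : ∀ {j e} → ¬ High j e → Low j e
  ¬High⇒Low ¬high R p ¬cov = ¬high (R , p , ¬cov)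

  -- Prolong a walk by a witness of High j q: its first read-once piece must pass q,
  -- or j pieces would suffice for the witness.
  low-high⇒good : ∀ {j e q} → Low (suc j) e → High j q → Good e q
  low-high⇒good {j} {e} {q} low (R , p , ¬cov) xs w x =
    decidable-stable (_ ℕ.≤? _) λ ¬once → low (xs ++ R) (w ++ᵖ p) λ c → ¬once (once c x)
    where
    once : Cov (suc j) (e ∷ xs ++ R) → ReadOnce Z _≟_ (e ∷ xs)
    once (ps , qs , eq , once-ps , c) with walk-last w
    ... | zs , eq′
      with ++-split zs ps (trans (trans (sym (List.++-assoc zs (q ∷ []) R)) (cong (_++ R) (sym eq′))) eq)
    ...   | inj₂ (rs , _ , refl) = ⊥-elim (¬cov (Cov-drop j rs c))
    ...   | inj₁ ([] , _ , refl) = ⊥-elim (¬cov c)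
    ...   | inj₁ (r ∷ rs , refl , eq″) with List.∷-injective eq″
    ...     | refl , _ = readOnce-++ˡ (e ∷ xs) {rs}
              (subst (ReadOnce Z _≟_) (trans (sym (List.++-assoc zs (q ∷ []) rs)) (cong (_++ rs) (sym eq′))) once-ps)

  -- Segmentation of a path

  record Segment (P : E → Set) : Set where
    field
      first last : E
      between    : List E
      walk       : Walk first last between
      good       : Good first last
      all        : All P (first ∷ between)

  open Segment

  -- The run ends just before the first edge outside `H`, where the next segment will begin.
  scan : ∀ {H P : E → Set} → (∀ e → Dec (H e)) → ∀ {e v es} → Path Z (tgt Z e) v es → H e → All P (e ∷ es) →
    ∃₂ λ q xs → Walk e q xs × H q × All P (e ∷ xs) ×
      (tgt Z q ≡ v ⊎ ∃₂ λ e′ es′ → tgt Z q ≡ src Z e′ × Path Z (tgt Z e′) v es′ × ¬ H e′ × All P (e′ ∷ es′))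
  scan H? {e} [] h (pe ∷ []) = e , [] , [] , h , pe ∷ [] , inj₁ refl
  scan H? {e} (_∷_ {e = e′} {es = es} eq p) h (pe ∷ pes) with H? e′
  ... | no ¬h = e , [] , [] , h , pe ∷ [] , inj₂ (e′ , es , sym eq , p , ¬h , pes)
  ... | yes h′ with scan H? p h′ pes
  ...   | q , xs , w , hq , ps , rest = q , e′ ∷ xs , sym eq ∷ w , hq , pe ∷ ps , rest

  module _ {I : Set} {H : I → E → Set} (H? : ∀ f e → Dec (H f e)) where

    Owned : E → E → I → Set
    Owned e q f = ∀ xs → Walk e q xs → Any (H f) (e ∷ xs)

    ¬Owned⇒avoiding : ∀ {e q f} → ¬ Owned e q f → ¬ ¬ (∃ λ xs → Walk e q xs × ¬ Any (H f) (e ∷ xs))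
    ¬Owned⇒avoiding {e} {f = f} ¬owned k = ¬owned λ xs w → decidable-stable (any? (H? f) (e ∷ xs)) λ ¬hit → k (xs , w , ¬hit)

    Avoidable : E → I → Set
    Avoidable e f = ∃ λ R → Path Z (tgt Z e) (sink Z) R × ¬ Any (H f) (e ∷ R)

    Segmentation : (E → Set) → ℕ → E → Set
    Segmentation P j e = Σ (Fin j → Segment P) λ s →
      ∀ f → (∀ i → ¬ Owned (first (s i)) (last (s i)) f) → ¬ ¬ Avoidable e f

    -- Induction on `j`: the initial run of edges in `High j` is a segment, good by `low-high⇒good`,
    -- and the edge after it is in `Low j`. For an index owned by no segment, the avoiding walks of
    -- the segments concatenate to a path to the sink.
    segments : ∀ {P} j {e es} → Path Z (tgt Z e) (sink Z) es → Low j e → All P (e ∷ es) →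
      ¬ ¬ Segmentation P j e
    segments zero p low ps k = low _ p λ ()
    segments {P} (suc j) {e} {es} p low ps k = ¬¬-Dec-Fin (High j) λ high? → step high? (high? e)
      where
      pad : ∀ i → ¬ High i e → Segmentation P i e → Segmentation P (suc i) e
      -- `High 0 e` always holds, since a path that begins with `e` is not empty.
      pad zero ¬high _ = ⊥-elim (¬high (es , p , λ ()))
      -- The first segment is repeated to fill the extra index.
      pad (suc i) _ (s , avoid) = (λ { zero → s zero ; (suc l) → s l }) , λ f ¬owned → avoid f (¬owned ∘ suc)

      step : (∀ e → Dec (High j e)) → Dec (High j e) → ⊥
      step high? (no ¬high) = segments j p (¬High⇒Low ¬high) ps (k ∘ pad j ¬high)
      step high? (yes high) with scan high? p high ps
      ... | q , xs , w , highq , pxs , rest = finish rest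
        where
        seg : Segment P
        seg = record { walk = w ; good = low-high⇒good low highq ; all = pxs }

        finish : (tgt Z q ≡ sink Z ⊎ ∃₂ λ e′ es′ → tgt Z q ≡ src Z e′ × Path Z (tgt Z e′) (sink Z) es′ ×
                   ¬ High j e′ × All P (e′ ∷ es′)) → ⊥
        finish (inj₁ end) = k ((λ _ → seg) , λ f ¬owned k′ → ¬Owned⇒avoiding (¬owned zero)
          λ (xs′ , w′ , ¬hit) → k′ (xs′ , subst (λ v → Path Z (tgt Z e) v xs′) end (walk⇒path w′) , ¬hit))
        finish (inj₂ (e′ , es′ , eq , p′ , ¬high , ps′)) = segments j p′ (¬High⇒Low ¬high) ps′
          λ (s , avoid) → k ((λ { zero → seg ; (suc i) → s i }) , λ f ¬owned k′ →
            ¬Owned⇒avoiding (¬owned zero) λ (xs′ , w′ , ¬hit) → avoid f (¬owned ∘ suc) λ (R , pR , ¬hitR) →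
              k′ (xs′ ++ e′ ∷ R , (w′ ++ᵖ (sym eq ∷ pR)) , [ ¬hit , ¬hitR ]′ ∘ Any.++⁻ (e ∷ xs′)))

  -- The fixed first argument is the initial edge of the segment in `Before` and its final edge in
  -- `After`. The edge `q` itself counts as before, so the two sides of a walk through `q` share no
  -- edge.
  Before After : E → E → X → Set
  Before e q x = ∃ λ xs → Walk e q xs × Occurs x (e ∷ xs)
  After e q x = ∃ λ ys → Walk q e ys × Occurs x ys

  module Cuts {e₁ e₂ : E} (good : Good e₁ e₂) where

    before-step : ∀ {q q′ x} → tgt Z q ≡ src Z q′ → Before e₁ q x → Before e₁ q′ x
    before-step eq (xs , w , o) = xs ++ _ ∷ [] , (w ++ʷ (eq ∷ [])) , Any.++⁺ˡ o

    after-step : ∀ {q q′ x} → tgt Z q ≡ src Z q′ → After e₂ q′ x → After e₂ q x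
    after-step eq (ys , w , o) = _ ∷ ys , eq ∷ w , there o

    -- The two walks join at `q` to a walk between the ends of the segment, which `good` makes
    -- read-once.
    before⇒¬after : ∀ {q x} → Before e₁ q x → ¬ After e₂ q x
    before⇒¬after (xs , w , o) (ys , w′ , o′) = readOnce-++⇒¬both (e₁ ∷ xs) (good (xs ++ ys) (w ++ʷ w′)) o o′

    before-first : ∀ {x} → Before e₁ e₁ x → var e₁ ≡ just x
    before-first (xs , w , o) with closed-walk w | o
    ... | refl | here eq = eq

    ¬after-last : ∀ {x} → ¬ After e₂ e₂ x
    ¬after-last (ys , w , o) with closed-walk w | o
    ... | refl | ()

    -- Otherwise a walk to q′ reading x earlier could be continued by a walk from q reading x again.
    after-before⇒var : ∀ {q q′ x} → tgt Z q ≡ src Z q′ → After e₂ q x → Before e₁ q′ x → var q′ ≡ just x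
    after-before⇒var {q} {q′} {x} eq (ys , w , o) (xs , w′ , o′) with unsnoc w′
    ... | inj₁ (refl , refl) with o′
    ...   | here v = v
    after-before⇒var {q} {q′} {x} eq (ys , w , o) (xs , w′ , o′) | inj₂ (zs , p , refl , v , eq′)
      with Any.++⁻ (e₁ ∷ zs) o′
    ... | inj₂ (here r) = r
    ... | inj₁ early = ⊥-elim (readOnce-++⇒¬both (e₁ ∷ zs) (good (zs ++ ys) (v ++ʷ redirect w o)) early o)
      where
      -- `p` and `q` end in the same node, so the walk after `q` also continues `p`; it is not empty
      -- because it reads `x`.
      redirect : ∀ {ys} → Walk q e₂ ys → Occurs x ys → Walk p e₂ ys
      redirect (eq₂ ∷ w) _ = trans eq′ (trans (sym eq) eq₂) ∷ w

  -- Past the end of the list, the last edge is repeated.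
  at : E → List E → ℕ → E
  at e [] j = e
  at e (x ∷ xs) zero = e
  at e (x ∷ xs) (suc j) = at x xs j

  at-split : ∀ {e q xs} → Walk e q xs → ∀ j → ∃₂ λ ys zs → Walk e (at e xs j) ys × Walk (at e xs j) q zs × xs ≡ ys ++ zs
  at-split [] j = [] , [] , [] , [] , refl
  at-split w@(_ ∷ _) zero = [] , _ , [] , w , refl
  at-split (_∷_ {e′ = e′} eq w) (suc j) with at-split w j
  ... | ys , zs , v , v′ , refl = e′ ∷ ys , zs , eq ∷ v , v′ , refl

  at-step : ∀ {e q xs} → Walk e q xs → ∀ j →
    (at e xs j ≡ q × at e xs (suc j) ≡ q) ⊎ tgt Z (at e xs j) ≡ src Z (at e xs (suc j))
  at-step [] j = inj₁ (refl , refl)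
  at-step (eq ∷ []) zero = inj₂ eq
  at-step (eq ∷ _ ∷ _) zero = inj₂ eq
  at-step (eq ∷ w) (suc j) = at-step w j

  at-zero : ∀ e xs → at e xs 0 ≡ e
  at-zero e [] = refl
  at-zero e (_ ∷ _) = refl

  at-last : ∀ {e q xs} → Walk e q xs → at e xs (length xs) ≡ q
  at-last [] = refl
  at-last (_ ∷ w) = at-last w

-- The CNF ψ(G)

module Psi (G : Graph) where

  X : Set
  X = PsiVar G

  Assigned : Set
  Assigned = Vec Bool (n G)

  end₁ end₂ : Fin (m G) → Fin (n G)
  end₁ f = proj₁ (ends G f)
  end₂ f = proj₂ (ends G f)

  -- The edge variables are true only where ψ(G) needs them.
  assign : Assigned → Assignment X
  assign U (inj₁ v) = lookup U v
  assign U (inj₂ f) = not (lookup U (end₁ f)) ∧ not (lookup U (end₂ f))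

  assign-sat : ∀ U → SatCNF (psi G) (assign U)
  assign-sat U = All.map⁺ (All.tabulate λ {f} _ → clause f)
    where
    clause : ∀ f → Any (Holds (assign U)) (psiClause G f)
    clause f with lookup U (end₁ f) in eq₁ | lookup U (end₂ f) in eq₂
    ... | true | _ = here eq₁
    ... | false | true = there (there (here eq₂))
    ... | false | false = there (here (cong₂ (λ a b → not a ∧ not b) eq₁ eq₂))

  data InClause (f : Fin (m G)) : X → Set where
    edge   : InClause f (inj₂ f)
    vertex : ∀ {v} → Incident G v f → InClause f (inj₁ v)

  InClause? : ∀ f x → Dec (InClause f x)
  InClause? f (inj₂ g) with f ≟ᶠ g
  ... | yes refl = yes edge
  ... | no f≢g = no λ { edge → f≢g refl }
  InClause? f (inj₁ v) with Incident? G v f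
  ... | yes vf = yes (vertex vf)
  ... | no ¬vf = no λ { (vertex vf) → ¬vf vf }

  other-end : ∀ {v f} → Incident G v f → ∃ λ u → Incident G u f × u ≢ v
  other-end {f = f} (inj₁ refl) = end₂ f , inj₂ refl , loopless G f ∘ sym
  other-end {f = f} (inj₂ refl) = end₁ f , inj₁ refl , loopless G f

  edge-true⇒end-false : ∀ {U v f} → Incident G v f → assign U (inj₂ f) ≡ true → lookup U v ≡ false
  edge-true⇒end-false {U} {f = f} vf eq with lookup U (end₁ f) in eq₁ | lookup U (end₂ f) in eq₂
  edge-true⇒end-false (inj₁ refl) eq | false | false = eq₁
  edge-true⇒end-false (inj₂ refl) eq | false | false = eq₂

  -- Without edges there are no vertices either, so decompositions without bags suffice. This serves
  -- the case where the source is the sink.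
  isolated-free-edgeless : NoIsolatedVertices G → ¬ Fin (m G) → ∀ d w → DPathwidthAtMost G (suc d) w
  isolated-free-edgeless noIso edgeless d w =
    (λ _ → record { VS = ⊤ˢ ; ES = ⊥ˢ ; closed = λ _ _ → Subset.∈⊤ , Subset.∈⊤ })
    , (λ v → ⊥-elim (no-vertex v)) , (λ f → ⊥-elim (edgeless f)) , λ _ → record
      { r = 0 ; bag = λ () ; bag⊆ = λ () ; vertexCover = λ v _ → ⊥-elim (no-vertex v)
      ; edgeCover = λ f _ → ⊥-elim (edgeless f) ; interpolation = λ () ; width≤ = λ () }
    where
    no-vertex : ¬ Fin (n G)
    no-vertex v = edgeless (proj₁ (noIso v))

  -- Monotone programs and the clauses they force

  module Program (Z : NBP X) (mono : Monotone Z) where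

    open Walks Z (psiVar-dec G) public

    Hits : Fin (m G) → E → Set
    Hits f e = ∃ λ x → var e ≡ just x × InClause f x

    Hits? : ∀ f e → Dec (Hits f e)
    Hits? f e with var e
    ... | nothing = no λ ()
    ... | just x with InClause? f x
    ...   | yes c = yes (x , refl , c)
    ...   | no ¬c = no λ { (_ , refl , c) → ¬c c }

    Own : E → E → Fin (m G) → Set
    Own = Owned Hits?

    TrueAt : Assignment X → E → Set
    TrueAt S e = ∀ x → var e ≡ just x → S x ≡ true

    holds⇒true : ∀ {S} es → All (Holds S) (labels Z es) → All (TrueAt S) es
    holds⇒true [] _ = []
    holds⇒true {S} (e ∷ es) hs with label Z e in eq
    ... | nothing = no-var ∷ holds⇒true es hs
      where
      no-var : TrueAt S e
      no-var x v rewrite eq with () ← v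
    ... | just (neg x) = ⊥-elim (mono e x eq)
    holds⇒true {S} (e ∷ es) (h ∷ hs) | just (pos x) = at-e ∷ holds⇒true es hs
      where
      at-e : TrueAt S e
      at-e y v rewrite eq with refl ← v = h

    true⇒holds : ∀ {S} es → All (TrueAt S) es → All (Holds S) (labels Z es)
    true⇒holds [] _ = []
    true⇒holds (e ∷ es) (t ∷ ts) with label Z e in eq
    ... | nothing = true⇒holds es ts
    ... | just (neg x) = ⊥-elim (mono e x eq)
    ... | just (pos x) = t x refl ∷ true⇒holds es ts

    consistent : ∀ es → Consistent Z es
    consistent es x (_ , neg∈) = no-neg es neg∈
      where
      no-neg : ∀ es → ¬ neg x ∈ˡ labels Z es
      no-neg (e ∷ es) neg∈ with label Z e in eq
      ... | nothing = no-neg es neg∈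
      no-neg (e ∷ es) (here refl) | just _ = mono e x eq
      no-neg (e ∷ es) (there neg∈) | just _ = no-neg es neg∈

    Occurs? : ∀ es x → Dec (Occurs x es)
    Occurs? es x = any? (λ e → var? (var e)) es
      where
      var? : ∀ y → Dec (y ≡ just x)
      var? y = Maybe.≡-dec (psiVar-dec G) y (just x)

    -- By monotonicity the assignment that makes just the variables on the path true satisfies Z.
    path-hits : Represents Z (psi G) → ∀ es → Path Z (source Z) (sink Z) es → ∀ f → Any (Hits f) es
    path-hits (_ , rep) es p f = hit (All.lookup sat (∈-map⁺ (psiClause G) (∈-allFin f)))
      where
      S : Assignment X
      S x = does (Occurs? es x)
      occurs : ∀ {x} → S x ≡ true → Occurs x es
      occurs {x} eq with Occurs? es x
      ... | yes o = o
      sat : SatCNF (psi G) S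
      sat = Equivalence.to (rep S) (es , p , consistent es , true⇒holds es
        (All.tabulate λ {e} e∈ x v → dec-true (Occurs? es x) (lose e∈ v)))
      hits : ∀ {x} → InClause f x → S x ≡ true → Any (Hits f) es
      hits {x} c eq = Any.map (λ v → x , v , c) (occurs eq)
      hit : Any (Holds S) (psiClause G f) → Any (Hits f) es
      hit (here eq) = hits (vertex (inj₁ refl)) eq
      hit (there (here eq)) = hits edge eq
      hit (there (there (here eq))) = hits (vertex (inj₂ refl)) eq

    -- A hit by the variable of `f` makes both ends false in `U`; a hit by a vertex must come from
    -- `u`, since `v` is not read, and then `u` is true.
    forced : ∀ {U es f u v} → Incident G u f → Incident G v f → u ≢ v → All (TrueAt (assign U)) es →
      Any (Hits f) es → ¬ Occurs (inj₁ v) es → Implies U (u , v)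
    forced {U} {es} {f} {u} {v} uf vf u≢v trues hit ¬occ with find hit
    ... | e , e∈ , _ , ve , edge
      rewrite edge-true⇒end-false {U} vf (All.lookup trues e∈ _ ve) = ∨-zeroʳ (lookup U u)
    ... | e , e∈ , _ , ve , vertex {w} wf with third-incident G {f} wf uf vf u≢v
    ...   | inj₁ refl = cong (_∨ not (lookup U v)) (All.lookup trues e∈ _ ve)
    ...   | inj₂ refl = ⊥-elim (¬occ (lose e∈ ve))

    -- These are the events of the union bound. They record three edges instead of a path, so there
    -- are only `|Z|^3` of them.
    Through : E × E × E → Assigned → Set
    Through (e₁ , q , e₂) U = ∃₂ λ xs ys → Walk e₁ q xs × Walk q e₂ ys × All (TrueAt (assign U)) (e₁ ∷ xs ++ ys)

    module _ (e₁ q e₂ : E) (owned? : ∀ f → Dec (Own e₁ q f)) where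

      Crosses : Fin (m G) → Set
      Crosses f = Own e₁ e₂ f × (∃ λ v → Incident G v f × ¬ Before e₁ q (inj₁ v))
                              × (∃ λ v → Incident G v f × ¬ After e₂ q (inj₁ v))

      ForcedPair : Fin (m G) → Fin (n G) × Fin (n G) → Set
      ForcedPair f (a , b) = Incident G a f × Incident G b f × a ≢ b ×
        (∀ U → Through (e₁ , q , e₂) U → Implies U (a , b))

      -- If not all walks from e₁ to q hit the clause of f, then all walks from q to e₂ do.
      forcedPair : ∀ f → Crosses f → ∃ (ForcedPair f)
      forcedPair f (own , (v , vf , ¬before) , (w , wf , ¬after)) with owned? f
      ... | yes own₁ = let (u , uf , u≢v) = other-end {v} {f} vf in (u , v) , uf , vf , u≢v ,
        λ { U (xs , ys , w₁ , _ , trues) → forced {f = f} uf vf u≢v (All.++⁻ˡ (e₁ ∷ xs) trues) (own₁ xs w₁)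
              λ o → ¬before (xs , w₁ , o) }
      ... | no ¬own₁ = let (u , uf , u≢w) = other-end {w} {f} wf in (u , w) , uf , wf , u≢w ,
        λ { U (xs , ys , w₁ , w₂ , trues) → forced {f = f} uf wf u≢w (All.++⁻ʳ (e₁ ∷ xs) trues) (second ys w₂)
              λ o → ¬after (ys , w₂ , o) }
        where
        second : ∀ ys → Walk q e₂ ys → Any (Hits f) ys
        second ys w₂ = decidable-stable (any? (Hits? f) ys) λ ¬hit → ¬own₁ λ xs w₁ →
          [ id , ⊥-elim ∘ ¬hit ]′ (Any.++⁻ (e₁ ∷ xs) (own (xs ++ ys) (w₁ ++ʷ w₂)))

      -- Disjoint edges yield pairs without common vertices; the last component places the pairs
      -- inside the matching, which the induction uses for `Apart`.
      forcedPairs : ∀ fs → Matching G fs → All Crosses fs → ∃ λ ps → length ps ≡ length fs × Independent ps ×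
        (∀ U → Through (e₁ , q , e₂) U → All (Implies U) ps) ×
        All (λ (a , b) → Covered G fs a × Covered G fs b) ps
      forcedPairs [] _ _ = [] , refl , ([] , []) , (λ _ _ → []) , []
      forcedPairs (f ∷ fs) (disj ∷ M) (c ∷ cs) with forcedPair f c | forcedPairs fs M cs
      ... | (a , b) , af , bf , a≢b , imp | ps , len , (apart , proper) , imps , cov =
        (a , b) ∷ ps , cong suc len ,
        (All.map (λ (ca , cb) → (clash af ca , clash af cb) , (clash bf ca , clash bf cb)) cov ∷ apart , a≢b ∷ proper) ,
        (λ U th → imp U th ∷ imps U th) ,
        ((f , here refl , af) , (f , here refl , bf)) ∷ All.map (λ (ca , cb) → weaken ca , weaken cb) cov
        where
        clash : ∀ {v w} → Incident G v f → Covered G fs w → v ≢ w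
        clash vf (g , g∈ , wg) refl = All.lookup disj g∈ _ vf wg
        weaken : ∀ {v} → Covered G fs v → Covered G (f ∷ fs) v
        weaken (g , g∈ , vg) = g , there g∈ , vg

      -- A larger matching is truncated to `t + 1` edges, since `Fooled` fixes the number of
      -- clauses.
      few-crossings : ∀ {t} → ¬ Fooled (suc t) (Through (e₁ , q , e₂)) → ∀ fs → Matching G fs → All Crosses fs →
        length fs ≤ t
      few-crossings {t} ¬fooled fs M cs = ℕ.≮⇒≥ λ t< →
        let (ps , len , ind , imps , _) = forcedPairs (take (suc t) fs) (AllPairs.take⁺ (suc t) M) (All.take⁺ (suc t) cs)
        in ¬fooled (ps , trans len (trans (List.length-take (suc t) fs) (ℕ.m≤n⇒m⊓n≡m t<)) , ind , imps)

    -- From a suitable assignment to the covering subgraphs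

    record Oracle : Set where
      field
        owned?  : ∀ e q f → Dec (Own e q f)
        before? : ∀ e q (v : Fin (n G)) → Dec (Before e q (inj₁ v))
        after?  : ∀ e q (v : Fin (n G)) → Dec (After e q (inj₁ v))

    oracle : ¬ ¬ Oracle
    oracle k =
      ¬¬-Fin (λ e → ¬¬-Fin λ q → ¬¬-Dec-Fin (Own e q)) λ owned? →
      ¬¬-Fin (λ e → ¬¬-Fin λ q → ¬¬-Dec-Fin (Before e q ∘ inj₁)) λ before? →
      ¬¬-Fin (λ e → ¬¬-Fin λ q → ¬¬-Dec-Fin (After e q ∘ inj₁)) λ after? →
      k record { owned? = owned? ; before? = before? ; after? = after? }

    module SegmentLayout (O : Oracle) {U t} (spared : ∀ τ → Through τ U → ¬ Fooled (suc t) (Through τ))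
      (σ : Segment (TrueAt (assign U))) where

      open Oracle O
      open Segment σ
      open Cuts good

      q : ℕ → E
      q = at first between

      -- Time j + 1 is the cut at the j-th edge; at time 0 nothing has been read.
      A B : ℕ → Fin (n G) → Set
      A zero v = ⊥
      A (suc j) v = Before first (q j) (inj₁ v)
      B zero v = ⊤
      B (suc j) v = After last (q j) (inj₁ v)

      A? : ∀ j v → Dec (A j v)
      A? zero v = no λ ()
      A? (suc j) v = before? first (q j) v

      B? : ∀ j v → Dec (B j v)
      B? zero v = yes tt
      B? (suc j) v = after? last (q j) v

      A-mono : ∀ j {v} → A j v → A (suc j) v
      A-mono (suc j) {v} a with at-step walk j
      ... | inj₁ (eq , eq′) = subst (λ e → Before first e (inj₁ v)) (trans eq (sym eq′)) a
      ... | inj₂ eq = before-step eq a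

      B-anti : ∀ j {v} → B (suc j) v → B j v
      B-anti zero _ = tt
      B-anti (suc j) {v} b with at-step walk j
      ... | inj₁ (eq , eq′) = subst (λ e → After last e (inj₁ v)) (trans eq′ (sym eq)) b
      ... | inj₂ eq = after-step eq b

      A∩B : ∀ j {v} → A j v → ¬ B j v
      A∩B (suc j) = before⇒¬after

      same-var : ∀ {e u v} → var e ≡ just (inj₁ u) → var e ≡ just (inj₁ v) → u ≡ v
      same-var eq eq′ with trans (sym eq) eq′
      ... | refl = refl

      jump : ∀ j {u v} → u ≢ v → B j u → B j v → A (suc j) u → ¬ A (suc j) v
      -- At time 0 every vertex is in `B`; what remains is that the first edge reads at most one
      -- vertex.
      jump zero {u} {v} u≢v _ _ au av rewrite at-zero first between =
        u≢v (same-var (before-first au) (before-first av))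
      jump (suc j) {u} {v} u≢v bu bv au av with at-step walk j
      ... | inj₁ (eq , _) = ¬after-last (subst (λ e → After last e (inj₁ u)) eq bu)
      ... | inj₂ eq = u≢v (same-var (after-before⇒var eq bu au) (after-before⇒var eq bv av))

      open Layout G (owned? first last) A? B? A-mono B-anti A∩B jump (suc (length between)) (λ _ → tt)
        (λ v b → ¬after-last (subst (λ e → After last e (inj₁ v)) (at-last walk) b)) public

      through : ∀ j → Through (first , q j , last) U
      through j with at-split walk j
      ... | xs , ys , w , w′ , eq = xs , ys , w , w′ , subst (λ zs → All (TrueAt (assign U)) (first ∷ zs)) eq all

      bound : ∀ j fs → Matching G fs → All (Crossing j) fs → length fs ≤ t
      bound zero [] _ _ = z≤n
      -- Nothing crosses at time 0, because `B` then contains every vertex.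
      bound zero (f ∷ _) _ ((_ , _ , v , _ , ¬b) ∷ _) = ⊥-elim (¬b tt)
      bound (suc j) fs M cs = few-crossings first (q j) last (owned? first (q j)) {t}
        (spared _ (through j)) fs M cs

    decode : Fin (M Z * (M Z * M Z)) → E × E × E
    decode i = let (a , j) = remQuot (M Z * M Z) i in a , remQuot (M Z) j

    encode : ∀ τ → ∃ λ i → decode i ≡ τ
    encode (a , b , c) = combine a (combine b c) , eq
      where
      eq : decode (combine a (combine b c)) ≡ (a , b , c)
      eq = trans (cong (λ (x , j) → x , remQuot (M Z) j) (Fin.remQuot-combine a (combine b c)))
                 (cong (a ,_) (Fin.remQuot-combine b c))

    -- Contrapositive of the size bound: a small program has an assignment whose accepting path
    -- meets only small cuts, and the segments of that path supply the subgraphs.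
    dpathwidth : ∀ {d w t} → 1 ≤ d → IsSMNBP Z (psiVar-dec G) d → Represents Z (psi G) → NoIsolatedVertices G →
      4 * t ≤ w → M Z * (M Z * M Z) * 3 ^ suc t < 4 ^ suc t → ¬ ¬ DPathwidthAtMost G d w
    dpathwidth {suc d} {w} {t} _ (_ , _ , split) rep noIso 4t≤w small k =
      oracle λ O → ¬¬-Dec-Fin (λ i → Fooled (suc t) (Through (decode i))) λ fooled? →
      -- `U` is fixed before its path is known, which is why it must escape the fooled triples of
      -- all edges.
      let (U , spared) = avoid-fooled (Through ∘ decode) fooled? small
          (es , p , _ , holds) = Equivalence.from (proj₂ rep (assign U)) (assign-sat U)
      in main O U (λ τ → let (i , eq) = encode τ in
                      subst (λ τ → Through τ U → ¬ Fooled (suc t) (Through τ)) eq (spared i))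
           es p (holds⇒true es holds)
      where
      open Segment
      main : Oracle → ∀ U → (∀ τ → Through τ U → ¬ Fooled (suc t) (Through τ)) →
        ∀ es → Path Z (source Z) (sink Z) es → All (TrueAt (assign U)) es → ⊥
      main O U spared [] p _ = k (isolated-free-edgeless noIso (λ f → case path-hits rep [] p f of λ ()) d w)
      main O U spared (e ∷ es) (refl ∷ p) trues =
        segments Hits? (suc d) p low trues λ (s , avoid) → k (decomposition s avoid)
        where
        open Oracle O
        low : Low (suc d) e
        low R p′ ¬cov with split (e ∷ R) (refl ∷ p′)
        ... | Ps , len , refl′ , onces = ¬cov (subst (Cov (suc d)) refl′ (concat⇒Cov Ps len onces))
        decomposition : (s : Fin (suc d) → Segment (TrueAt (assign U))) →
          (∀ f → (∀ i → ¬ Own (first (s i)) (last (s i)) f) → ¬ ¬ Avoidable Hits? e f) → DPathwidthAtMost G (suc d) w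
        decomposition s avoid = (λ i → L.subgraph i) , (λ v → zero , Subset.∈⊤) , covered ,
          λ i → L.pathDecomposition i (L.bound i) 4t≤w
          where
          module L i = SegmentLayout O spared (s i)
          covered : ∀ f → ∃ λ i → f ∈ˢ ES (L.subgraph i)
          covered f with Fin.any? (λ i → owned? (first (s i)) (last (s i)) f)
          ... | yes (i , own) = i , ∈-comprehension⁺ (owned? (first (s i)) (last (s i))) own
          -- An edge of `G` owned by no segment would have its clause missed by a whole source-sink
          -- path, against `path-hits`.
          ... | no none = ⊥-elim (avoid f (λ i own → none (i , own)) λ (R , p′ , ¬hit) →
                            ¬hit (path-hits rep (e ∷ R) (refl ∷ p′) f))

-- Arithmetic of the final bound

^-distribʳ-* : ∀ x y j → (x * y) ^ j ≡ x ^ j * y ^ j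
^-distribʳ-* x y zero = refl
^-distribʳ-* x y (suc j) = trans (cong (x * y *_) (^-distribʳ-* x y j))
  (ℕ.[m*n]*[o*p]≡[m*o]*[n*p] x y (x ^ j) (y ^ j))

cube : ∀ s → s * (s * s) ≡ s ^ 3
cube s = cong (λ x → s * (s * x)) (sym (ℕ.*-identityʳ s))

-- (4/3)^(4t) ≤ s^12 with k ≤ 4t, and 8/7 ≤ 4/3.
size-bound : ∀ s k t → k ≤ t * 4 → 4 ^ t ≤ s * (s * s) * 3 ^ t → 8 ^ k ≤ s ^ 12 * 7 ^ k
size-bound s k t k≤4t le = ℕ.*-cancelʳ-≤ (8 ^ k) (s ^ 12 * 7 ^ k) (3 ^ k) {{ℕ.m^n≢0 3 k}} (begin
  8 ^ k * 3 ^ k ≡⟨ sym (^-distribʳ-* 8 3 k) ⟩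
  24 ^ k ≤⟨ ℕ.^-monoˡ-≤ k (ℕ.m≤m+n 24 4) ⟩
  28 ^ k ≡⟨ ^-distribʳ-* 4 7 k ⟩
  4 ^ k * 7 ^ k ≤⟨ ℕ.*-monoˡ-≤ (7 ^ k) step ⟩
  s ^ 12 * 3 ^ k * 7 ^ k ≡⟨ swap (s ^ 12) (3 ^ k) (7 ^ k) ⟩
  s ^ 12 * 7 ^ k * 3 ^ k ∎)
  where
  open ℕ.≤-Reasoning
  -- The slack between `k` and `4 * t`: both sides are raised to the full exponent, and
  -- `3 ^ r ≤ 4 ^ r` allows cancelling the surplus.
  r : ℕ
  r = t * 4 ∸ k
  swap : ∀ a b c → a * b * c ≡ a * c * b
  swap = solve-∀
  power : ∀ x → x ^ k * x ^ r ≡ (x ^ t) ^ 4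
  power x = trans (sym (ℕ.^-distribˡ-+-* x k r))
    (trans (cong (x ^_) (ℕ.m+[n∸m]≡n k≤4t)) (sym (ℕ.^-*-assoc x t 4)))
  step : 4 ^ k ≤ s ^ 12 * 3 ^ k
  step = ℕ.*-cancelʳ-≤ (4 ^ k) (s ^ 12 * 3 ^ k) (4 ^ r) {{ℕ.m^n≢0 4 r}} (begin
    4 ^ k * 4 ^ r ≡⟨ power 4 ⟩
    (4 ^ t) ^ 4 ≤⟨ ℕ.^-monoˡ-≤ 4 le ⟩
    (s * (s * s) * 3 ^ t) ^ 4 ≡⟨ ^-distribʳ-* (s * (s * s)) (3 ^ t) 4 ⟩
    (s * (s * s)) ^ 4 * (3 ^ t) ^ 4
      ≡⟨ cong₂ _*_ (trans (cong (_^ 4) (cube s)) (ℕ.^-*-assoc s 3 4)) (sym (power 3)) ⟩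
    s ^ 12 * (3 ^ k * 3 ^ r) ≤⟨ ℕ.*-monoʳ-≤ (s ^ 12) (ℕ.*-monoʳ-≤ (3 ^ k) (ℕ.^-monoˡ-≤ r (ℕ.n≤1+n 3))) ⟩
    s ^ 12 * (3 ^ k * 4 ^ r) ≡⟨ sym (ℕ.*-assoc (s ^ 12) (3 ^ k) (4 ^ r)) ⟩
    s ^ 12 * 3 ^ k * 4 ^ r ∎)

-- The constant c is the rational `p / q`; the twelfth power of the inequality, with denominators
-- cleared, avoids real roots.
theorem5 : Σ ℕ λ p → Σ ℕ λ q → 1 ≤ p × 1 ≤ q ×
    ((d k : ℕ) → 1 ≤ d → 1 ≤ k →
    (G : Graph) → NoIsolatedVertices G → DPathwidthAtLeast G d k →
    (Z : NBP (PsiVar G)) → IsSMNBP Z (psiVar-dec G) d → Represents Z (psi G) →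
    (p ^ 12) * (8 ^ k) ≤ (q ^ 12) * ((size Z ^ 12) * (7 ^ k)))
theorem5 = 1 , 1 , s≤s z≤n , s≤s z≤n , bound
  where
  bound : (d k : ℕ) → 1 ≤ d → 1 ≤ k →
    (G : Graph) → NoIsolatedVertices G → DPathwidthAtLeast G d k →
    (Z : NBP (PsiVar G)) → IsSMNBP Z (psiVar-dec G) d → Represents Z (psi G) →
    (1 ^ 12) * (8 ^ k) ≤ (1 ^ 12) * ((size Z ^ 12) * (7 ^ k))
  -- With `k = w + 1`, a program below the bound would give d-pathwidth at most `w`, a
  -- contradiction; the double negation is absorbed because the goal there is absurdity.
  bound d (suc w) 1≤d _ G noIso dpw Z smnbp rep = ℕ.*-monoʳ-≤ 1 (size-bound (size Z) (suc w) (suc t) k≤4t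
    (ℕ.≮⇒≥ λ small → Psi.Program.dpathwidth G Z (proj₁ smnbp) {t = t} 1≤d smnbp rep noIso 4t≤w small λ D →
      ℕ.1+n≰n (dpw w D)))
    where
    t : ℕ
    -- The largest `t` for which bags of `4 * t + 1` vertices respect width `w`; the remainder is at
    -- most 3, so `k` is at most `4 * (t + 1)`.
    t = w / 4
    4t≤w : 4 * t ≤ w
    4t≤w = ℕ.≤-trans (ℕ.≤-reflexive (ℕ.*-comm 4 t)) (m/n*n≤m w 4)
    k≤4t : suc w ≤ suc t * 4
    k≤4t = ℕ.≤-trans (s≤s (ℕ.≤-reflexive (m≡m%n+[m/n]*n w 4))) (ℕ.+-monoˡ-≤ (t * 4) (m%n<n w 4))
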